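{- Definable functions in $\mathrm{FO}(\mathbb{Z},+,\leq)$ are exactly the $\mathrm{FO}(\mathbb{Z},+,\leq)$-piecewise linear functions. That is, a partially defined function $f:\mathbb{R}^n\to\mathbb{R}^q$ is definable in $\mathrm{FO}(\mathbb{Z},+,\leq)$ if and only if $f$ is $\mathrm{FO}(\mathbb{Z},+,\leq)$-piecewise linear.
   Context: Functions are partial: $f:X\to Y$ is defined on a set $\mathrm{dom}(f)\subseteq X$, and its graph is $G_f=\{(x,y)\in X\times Y\mid x\in\mathrm{dom}(f),\ y=f(x)\}$. The restriction of $f$ to $D\subseteq\mathrm{dom}(f)$ is denoted $f|_D$. $\mathrm{FO}(\mathbb{Z},+,\leq)$ is the first-order logic of the integers with addition and order (Presburger arithmetic). A set is definable in $\mathrm{FO}(\mathbb{Z},+,\leq)$ if it is the set of integer tuples satisfying some formula of this logic; in particular a definable set is a subset of some $\mathbb{Z}^m$. A partial function $f:\mathbb{R}^n\to\mathbb{R}^q$ is definable in $\mathrm{FO}(\mathbb{Z},+,\leq)$ if there is a formula $\psi(x,y)$ of this logic encoding its graph $G_f$. A partial function $f:\mathbb{R}^n\to\mathbb{R}^q$ is linear (short for $\mathbb{Q}$-linear; "affine" in other terminology) if there exist a matrix $M\in\mathbb{Q}^{q\times n}$ and a vector $v\in\mathbb{Q}^q$ such that $f(a)=Ma+v$ for all $a\in\mathrm{dom}(f)$. A partial function $f:\mathbb{R}^n\to\mathbb{R}^q$ is $\mathrm{FO}(\mathbb{Z},+,\leq)$-piecewise linear if there is a finite partition $\Pi$ of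 $\mathrm{dom}(f)$ such that every $X\in\Pi$ is definable in $\mathrm{FO}(\mathbb{Z},+,\leq)$ and $f|_X$ is linear for every $X\in\Pi$.
   Formalization: For "piecewise linear implies definable", f is additionally required to take values in ℤ^q, because x ↦ x/2 on ℤ is piecewise linear but its graph is not a set of integer tuples; "definable implies piecewise linear" has no added hypothesis. -}

module Defs where

open import Level using (Level; _⊔_; suc; 0ℓ)
open import Data.Nat as ℕ using (ℕ)
import Data.Nat.Properties as ℕ
open import Data.Integer as ℤ using (ℤ)
open import Data.Rational using (ℚ; 0ℚ; 1ℚ; ½; _+_; _*_; _-_; _≤_; _<_; ∣_∣; _/_; 1/_; Positive; NonZero)
import Data.Rational.Properties as ℚ
open import Data.Rational.Solver using (module +-*-Solver)
open import Data.Fin using (Fin)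
open import Data.Vec using (Vec; []; _∷_; _++_; map; lookup; zipWith)
import Data.Vec.Relation.Binary.Equality.Setoid as VecEquality
open import Data.Product using (∃; ∃-syntax; ∃₂; _×_; _,_)
open import Data.Sum using (_⊎_)
open import Relation.Nullary using (¬_)
open import Relation.Unary using (Pred; Satisfiable)
open import Relation.Binary using (Rel; Setoid; Reflexive; Symmetric; Transitive; _Respects_)
open import Relation.Binary.PropositionalEquality using (_≡_; _≢_; refl; sym; trans; cong; subst)

private
  variable
    ℓ ℓ₁ ℓ₂ : Level
    m n q : ℕ

-- Real numbers: Cauchy sequences of rationals (with a modulus, carried by the
-- constructive ∃), taken up to the equivalence _≈_.

Cauchy : (ℕ → ℚ) → Set
Cauchy s = ∀ ε → 0ℚ < ε → ∃[ N ] (∀ {i j} → N ℕ.≤ i → N ℕ.≤ j → ∣ s i - s j ∣ < ε)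

record ℝ : Set where
  constructor mkℝ
  field
    seq    : ℕ → ℚ
    cauchy : Cauchy seq

open ℝ public

infix 4 _≈_

_≈_ : Rel ℝ 0ℓ
x ≈ y = ∀ ε → 0ℚ < ε → ∃[ N ] (∀ {i} → N ℕ.≤ i → ∣ seq x i - seq y i ∣ < ε)

½ε+½ε : ∀ ε → ½ * ε + ½ * ε ≡ ε
½ε+½ε ε = trans (sym (ℚ.*-distribʳ-+ ε ½ ½)) (ℚ.*-identityˡ ε)

½ε>0 : ∀ {ε} → 0ℚ < ε → 0ℚ < ½ * ε
½ε>0 {ε} ε>0 = subst (_< ½ * ε) (ℚ.*-zeroʳ ½) (ℚ.*-monoʳ-<-pos ½ ε>0)

∣p-p∣<ε : ∀ p {ε} → 0ℚ < ε → ∣ p - p ∣ < ε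
∣p-p∣<ε p {ε} = subst (_< ε) (cong ∣_∣ (sym (ℚ.+-inverseʳ p)))

half-sum : ∀ {a b c ε} → c ≡ a + b → ∣ a ∣ < ½ * ε → ∣ b ∣ < ½ * ε → ∣ c ∣ < ε
half-sum {a} {b} {c} {ε} refl a< b< =
  subst (∣ c ∣ <_) (½ε+½ε ε) (ℚ.≤-<-trans (ℚ.∣p+q∣≤∣p∣+∣q∣ a b) (ℚ.+-mono-< a< b<))

∣p-q∣≡∣q-p∣ : ∀ p q → ∣ p - q ∣ ≡ ∣ q - p ∣
∣p-q∣≡∣q-p∣ p q = trans (sym (ℚ.∣-p∣≡∣p∣ (p - q))) (cong ∣_∣ (solve 2 (λ p q → :- (p :- q) := q :- p) refl p q))
  where open +-*-Solver

≈-refl : Reflexive _≈_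
≈-refl {x} ε ε>0 = 0 , λ {i} _ → ∣p-p∣<ε (seq x i) ε>0

≈-sym : Symmetric _≈_
≈-sym {x} {y} x≈y ε ε>0 with x≈y ε ε>0
... | N , h = N , λ {i} N≤i → subst (_< ε) (∣p-q∣≡∣q-p∣ (seq x i) (seq y i)) (h N≤i)

≈-trans : Transitive _≈_
≈-trans {x} {y} {z} x≈y y≈z ε ε>0 with x≈y (½ * ε) (½ε>0 ε>0) | y≈z (½ * ε) (½ε>0 ε>0)
... | N , h | N′ , h′ = N ℕ.⊔ N′ , λ {i} le → half-sum
    (solve 3 (λ x y z → x :- z := (x :- y) :+ (y :- z)) refl (seq x i) (seq y i) (seq z i))
    (h (ℕ.≤-trans (ℕ.m≤m⊔n N N′) le)) (h′ (ℕ.≤-trans (ℕ.m≤n⊔m N N′) le))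
  where open +-*-Solver

ℝ-setoid : Setoid 0ℓ 0ℓ
ℝ-setoid = record
  { Carrier       = ℝ
  ; _≈_           = _≈_
  ; isEquivalence = record
    { refl  = λ {x} → ≈-refl {x}
    ; sym   = λ {x y} → ≈-sym {x} {y}
    ; trans = λ {x y z} → ≈-trans {x} {y} {z}
    }
  }

-- _≋_ is componentwise _≈_.
open VecEquality ℝ-setoid public using (_≋_; ≋-trans)

module Scale (c ε : ℚ) (ε>0 : 0ℚ < ε) where
  k : ℚ
  k = ∣ c ∣ + 1ℚ

  instance
    k-pos : Positive k
    k-pos = ℚ.nonNeg+pos⇒pos ∣ c ∣ {{ℚ.∣-∣-nonNeg c}} 1ℚ

    k-nonZero : NonZero k
    k-nonZero = ℚ.pos⇒nonZero k

    1/k-pos : Positive (1/ k)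
    1/k-pos = ℚ.1/pos⇒pos k

  δ : ℚ
  δ = 1/ k * ε

  δ>0 : 0ℚ < δ
  δ>0 = subst (_< δ) (ℚ.*-zeroʳ (1/ k)) (ℚ.*-monoʳ-<-pos (1/ k) ε>0)

  kδ≡ε : k * δ ≡ ε
  kδ≡ε = trans (sym (ℚ.*-assoc k (1/ k) ε)) (trans (cong (_* ε) (ℚ.*-inverseʳ k)) (ℚ.*-identityˡ ε))

  ∣c∣≤k : ∣ c ∣ ≤ k
  ∣c∣≤k = subst (_≤ k) (ℚ.+-identityʳ ∣ c ∣) (ℚ.+-monoʳ-≤ ∣ c ∣ (ℚ.<⇒≤ (ℚ.positive⁻¹ 1ℚ)))

  bound : ∀ a b → ∣ a - b ∣ < δ → ∣ c * a - c * b ∣ < ε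
  bound a b a-b<δ = begin-strict
    ∣ c * a - c * b ∣  ≡⟨ cong ∣_∣ (solve 3 (λ c a b → c :* a :- c :* b := c :* (a :- b)) refl c a b) ⟩
    ∣ c * (a - b) ∣    ≡⟨ ℚ.∣p*q∣≡∣p∣*∣q∣ c (a - b) ⟩
    ∣ c ∣ * ∣ a - b ∣  ≤⟨ ℚ.*-monoʳ-≤-nonNeg ∣ a - b ∣ {{ℚ.∣-∣-nonNeg (a - b)}} ∣c∣≤k ⟩
    k * ∣ a - b ∣      <⟨ ℚ.*-monoʳ-<-pos k a-b<δ ⟩
    k * δ              ≡⟨ kδ≡ε ⟩
    ε                  ∎
    where open ℚ.≤-Reasoning
          open +-*-Solver

-- The Cauchy proofs are abstract so that they are never unfolded when reals
-- are compared for definitional equality.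
abstract
  const-cauchy : ∀ p → Cauchy (λ _ → p)
  const-cauchy p ε ε>0 = 0 , λ _ _ → ∣p-p∣<ε p ε>0

  +-cauchy : ∀ x y → Cauchy (λ i → seq x i + seq y i)
  +-cauchy x y ε ε>0 with cauchy x (½ * ε) (½ε>0 ε>0) | cauchy y (½ * ε) (½ε>0 ε>0)
  ... | N , h | N′ , h′ = N ℕ.⊔ N′ , λ {i} {j} le le′ → half-sum
      (solve 4 (λ a b c d → (a :+ b) :- (c :+ d) := (a :- c) :+ (b :- d)) refl
         (seq x i) (seq y i) (seq x j) (seq y j))
      (h  (ℕ.≤-trans (ℕ.m≤m⊔n N N′) le) (ℕ.≤-trans (ℕ.m≤m⊔n N N′) le′))
      (h′ (ℕ.≤-trans (ℕ.m≤n⊔m N N′) le) (ℕ.≤-trans (ℕ.m≤n⊔m N N′) le′))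
    where open +-*-Solver

  ·-cauchy : ∀ c x → Cauchy (λ i → c * seq x i)
  ·-cauchy c x ε ε>0 with cauchy x (Scale.δ c ε ε>0) (Scale.δ>0 c ε ε>0)
  ... | N , h = N , λ {i} {j} le le′ → Scale.bound c ε ε>0 (seq x i) (seq x j) (h le le′)

fromℚ : ℚ → ℝ
fromℚ p = mkℝ (λ _ → p) (const-cauchy p)

fromℤ : ℤ → ℝ
fromℤ a = fromℚ (a / 1)

infixl 6 _+ℝ_
infixr 7 _·_

_+ℝ_ : ℝ → ℝ → ℝ
x +ℝ y = mkℝ (λ i → seq x i + seq y i) (+-cauchy x y)

-- Multiplication of a real by a rational; linear maps have rational coefficients.
_·_ : ℚ → ℝ → ℝ
c · x = mkℝ (λ i → c * seq x i) (·-cauchy c x)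

-- First-order formulas over the signature (+, ≤) with equality.  Variables are
-- de Bruijn indices: Formula m has m free variables, and a quantifier binds
-- variable zero of its body.

infixl 6 _+ᵗ_

data Term (m : ℕ) : Set where
  var  : Fin m → Term m
  _+ᵗ_ : Term m → Term m → Term m

infix  5 _≤ᶠ_ _≡ᶠ_
infixr 4 _∧ᶠ_
infixr 3 _∨ᶠ_
infixr 2 _⇒ᶠ_

data Formula (m : ℕ) : Set where
  _≤ᶠ_ _≡ᶠ_      : Term m → Term m → Formula m
  ¬ᶠ_            : Formula m → Formula m
  _∧ᶠ_ _∨ᶠ_ _⇒ᶠ_ : Formula m → Formula m → Formula m
  ∀ᶠ_ ∃ᶠ_        : Formula (ℕ.suc m) → Formula m

⟦_⟧ᵗ : Term m → Vec ℤ m → ℤ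
⟦ var i  ⟧ᵗ a = lookup a i
⟦ s +ᵗ t ⟧ᵗ a = ⟦ s ⟧ᵗ a ℤ.+ ⟦ t ⟧ᵗ a

-- Satisfaction in ℤ.  Since Presburger arithmetic is decidable by quantifier
-- elimination, the constructive reading of the connectives agrees with the
-- classical one.
infix 1 _⊨_

_⊨_ : Vec ℤ m → Formula m → Set
a ⊨ s ≤ᶠ t = ⟦ s ⟧ᵗ a ℤ.≤ ⟦ t ⟧ᵗ a
a ⊨ s ≡ᶠ t = ⟦ s ⟧ᵗ a ≡ ⟦ t ⟧ᵗ a
a ⊨ ¬ᶠ φ   = ¬ (a ⊨ φ)
a ⊨ φ ∧ᶠ ψ = (a ⊨ φ) × (a ⊨ ψ)
a ⊨ φ ∨ᶠ ψ = (a ⊨ φ) ⊎ (a ⊨ ψ)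
a ⊨ φ ⇒ᶠ ψ = (a ⊨ φ) → (a ⊨ ψ)
a ⊨ ∀ᶠ φ   = ∀ z → z ∷ a ⊨ φ
a ⊨ ∃ᶠ φ   = ∃[ z ] (z ∷ a ⊨ φ)

record Subset (m : ℕ) (ℓ : Level) : Set (suc ℓ) where
  field
    member   : Pred (Vec ℝ m) ℓ
    respects : member Respects _≋_

open Subset public

infix 4 _∈_ _⊆_

_∈_ : Vec ℝ m → Subset m ℓ → Set ℓ
x ∈ S = member S x

_⊆_ : Subset m ℓ₁ → Subset m ℓ₂ → Set (ℓ₁ ⊔ ℓ₂)
S ⊆ T = ∀ {x} → x ∈ S → x ∈ T

-- The set of integer tuples satisfying φ, inside ℝᵐ.
Solutions : Formula m → Subset m 0ℓ
Solutions {m} φ = record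
  { member   = λ x → ∃ λ (a : Vec ℤ m) → map fromℤ a ≋ x × (a ⊨ φ)
  ; respects = λ x≋y (a , a≋x , a⊨φ) → a , ≋-trans a≋x x≋y , a⊨φ
  }

DefinableSet : Subset m ℓ → Set ℓ
DefinableSet {m} S = ∃ λ (φ : Formula m) → S ⊆ Solutions φ × Solutions φ ⊆ S

record PartialFunction (n q : ℕ) (ℓ : Level) : Set (suc ℓ) where
  field
    dom        : Subset n ℓ
    apply      : ∀ x → x ∈ dom → Vec ℝ q
    apply-cong : ∀ {x y} (x∈ : x ∈ dom) (y∈ : y ∈ dom) → x ≋ y → apply x x∈ ≋ apply y y∈

open PartialFunction public

Graph : PartialFunction n q ℓ → Subset (n ℕ.+ q) ℓ
Graph f = record
  { member   = λ z → ∃₂ λ x (x∈ : x ∈ dom f) → x ++ apply f x x∈ ≋ z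
  ; respects = λ z≋z′ (x , x∈ , eq) → x , x∈ , ≋-trans eq z≋z′
  }

restrict : (f : PartialFunction n q ℓ) (D : Subset n ℓ) → D ⊆ dom f → PartialFunction n q ℓ
restrict f D D⊆ = record
  { dom        = D
  ; apply      = λ x x∈ → apply f x (D⊆ x∈)
  ; apply-cong = λ x∈ y∈ → apply-cong f (D⊆ x∈) (D⊆ y∈)
  }

Definable : PartialFunction n q ℓ → Set ℓ
Definable f = DefinableSet (Graph f)

Matrix : ℕ → ℕ → Set
Matrix q n = Vec (Vec ℚ n) q

dot : Vec ℚ n → Vec ℝ n → ℝ
dot []       []       = fromℚ 0ℚ
dot (c ∷ cs) (x ∷ xs) = c · x +ℝ dot cs xs

infixr 7 _*ᵥ_
infixl 6 _+ᵥ_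

_*ᵥ_ : Matrix q n → Vec ℝ n → Vec ℝ q
M *ᵥ a = map (λ row → dot row a) M

_+ᵥ_ : Vec ℝ q → Vec ℝ q → Vec ℝ q
_+ᵥ_ = zipWith _+ℝ_

Linear : PartialFunction n q ℓ → Set ℓ
Linear {n} {q} f = ∃₂ λ (M : Matrix q n) (v : Vec ℚ q) →
  ∀ a (a∈ : a ∈ dom f) → apply f a a∈ ≋ M *ᵥ a +ᵥ map fromℚ v

record FinitePartition (S : Subset n ℓ) : Set (suc ℓ) where
  field
    size     : ℕ
    block    : Fin size → Subset n ℓ
    nonempty : ∀ i → Satisfiable (member (block i))
    disjoint : ∀ {i j} → i ≢ j → ∀ x → x ∈ block i → ¬ (x ∈ block j)
    included : ∀ i → block i ⊆ S
    covers   : ∀ x → x ∈ S → ∃[ i ] (x ∈ block i)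

open FinitePartition public

PiecewiseLinear : PartialFunction n q ℓ → Set (suc ℓ)
PiecewiseLinear f = ∃ λ (Π : FinitePartition (dom f)) →
  (∀ i → DefinableSet (block Π i)) ×
  (∀ i → Linear (restrict f (block Π i) (included Π i)))

-- f (dom f) ⊆ ℤ^q.  Every definable f has this property, its graph being a set
-- of integer tuples, but a piecewise linear f need not: x ↦ x/2 on ℤ is linear
-- with definable domain, although its graph is not contained in ℤ².
IntegerValued : PartialFunction n q ℓ → Set ℓ
IntegerValued {q = q} f =
  ∀ x (x∈ : x ∈ dom f) → ∃ λ (b : Vec ℤ q) → apply f x x∈ ≋ map fromℤ b

{-# OPTIONS --safe #-}
-- Quantifier elimination without equalising coefficients.  Moving y by a multiple of the period
-- of a quantifier-free θ(y, a) keeps all divisibility atoms, so it changes the truth of θ only if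
-- y lies close to a zero of some inequality atom c y + u ≥ 0, that is, if c y + u(a) = k for one of
-- finitely many k.  Walking from a solution towards 0 thus ends either near 0 or near such a zero,
-- and ∃ y θ(y, a) is a finite disjunction over rational affine functions y = (k - u(a)) / c.
-- If θ(·, a) has at most one solution y, then θ fails at y + period, so y itself is a value of one
-- of these functions: a definable function agrees pointwise with finitely many affine ones, and
-- the sets on which it agrees with each are definable.  Decidability makes them a partition into
-- nonempty blocks.
module Submission where

open import Defs
import Algebra.Properties.AbelianGroup as AbelianGroup
open import Data.Bool using (Bool; false; T; not; _∧_; _∨_)
open import Data.Bool.Properties using (T-∧; T-∨)
open import Data.Fin as Fin using (Fin; zero; suc; _↑ˡ_; _↑ʳ_; splitAt)
open import Data.Integer as ℤ using (ℤ; +_; -[1+_]; +[1+_]; 0ℤ; 1ℤ; -1ℤ; _+_; _*_; -_; ∣_∣)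
open import Data.Integer.Divisibility.Signed using
  (_∣_; divides; _∣?_; ∣ᵤ⇒∣; ∣m∣n⇒∣m+n; ∣m+n∣n⇒∣m; ∣n⇒∣m*n; *-cancelˡ-∣; *-monoʳ-∣)
import Data.Integer.Properties as ℤ
open import Data.Integer.Tactic.RingSolver using (solve-∀)
open import Data.List as List using (List; []; _∷_; cartesianProductWith)
open import Data.List.Membership.Propositional as List using (lose)
import Data.List.Membership.Propositional.Properties as List
open import Data.List.Relation.Unary.All as All using (All; []; _∷_)
import Data.List.Relation.Unary.All.Properties as All
open import Data.List.Relation.Unary.AllPairs as AllPairs using (AllPairs; []; _∷_)
import Data.List.Relation.Unary.AllPairs.Properties as AllPairs
open import Data.List.Relation.Unary.Any as Any using (Any; here; there)
import Data.List.Relation.Unary.Any.Properties as Any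
open import Data.Nat as ℕ using (ℕ; zero; suc; z≤n; s≤s)
import Data.Nat.Divisibility as ℕ∣
open import Data.Nat.Induction using (<-wellFounded)
import Data.Nat.Properties as ℕ
open import Data.Product as Product using (∃; _×_; _,_; proj₁; proj₂)
open import Data.Product.Function.NonDependent.Propositional using (_×-⇔_)
open import Data.Rational as ℚ using (ℚ; 0ℚ; _/_)
import Data.Rational.Properties as ℚ
open import Data.Rational.Solver using (module +-*-Solver)
open import Data.Rational.Unnormalised as ℚᵘ using (mkℚᵘ; *≡*)
import Data.Rational.Unnormalised.Properties as ℚᵘ
open import Data.Sum as Sum using (_⊎_; inj₁; inj₂; [_,_]′)
open import Data.Sum.Function.Propositional using (_⊎-⇔_)
open import Data.Unit using (tt)
open import Data.Vec as Vec using (Vec; []; _∷_; lookup; zipWith; _++_)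
import Data.Vec.Properties as Vec
import Data.Vec.Relation.Binary.Equality.Setoid as VecEquality
open import Data.Vec.Relation.Binary.Pointwise.Extensional using (ext; extensional⇒inductive)
open import Data.Vec.Relation.Binary.Pointwise.Inductive as Pointwise using (Pointwise; []; _∷_)
open import Function using (_∘_; case_of_; _⇔_; mk⇔; Equivalence)
open import Function.Construct.Symmetry using (⇔-sym)
open import Function.Related.TypeIsomorphisms using (→-cong-⇔; ¬-cong-⇔)
open import Induction.WellFounded using (Acc; acc)
open import Level using (Level; 0ℓ; Lift; lift; lower)
open import Relation.Binary.PropositionalEquality
  using (_≡_; _≢_; refl; sym; trans; cong; cong₂; subst; module ≡-Reasoning)
open import Relation.Nullary using
  (Dec; yes; no; does; proof; ¬_; contradiction; Reflects; ofʸ; ofⁿ; _because_)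
open import Relation.Nullary.Decidable as Decidable using (does-⇔; map′)
open import Relation.Nullary.Reflects using
  (fromEquivalence; ¬-reflects; _×-reflects_; _⊎-reflects_; _→-reflects_)

open AbelianGroup ℤ.+-0-abelianGroup using (identityʳ-unique)
open AbelianGroup ℚ.+-0-abelianGroup using (x∙y⁻¹≈ε⇒x≈y)
open Equivalence using (to; from)
open VecEquality ℝ-setoid using (≋-refl; ≋-sym; ++⁺; ++⁻; map-++)

private
  variable
    ℓ : Level
    m n q : ℕ

-- Quantifier elimination

-- (c₁ ∷ … ∷ cₘ ∷ k ∷ []) is the form c₁ x₁ + … + cₘ xₘ + k.
Affine : ℕ → Set
Affine m = Vec ℤ (suc m)

⟦_⟧ᵃ : Affine m → Vec ℤ m → ℤ
⟦ k ∷ _ ⟧ᵃ []      = k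
⟦ c ∷ u ⟧ᵃ (y ∷ a) = c * y + ⟦ u ⟧ᵃ a

infixl 6 _⊕_
infixr 7 _⊛_

_⊕_ : Affine m → Affine m → Affine m
_⊕_ = zipWith _+_

_⊛_ : ℤ → Affine m → Affine m
k ⊛ u = Vec.map (k *_) u

constant : ℤ → Affine m
constant {zero}  k = k ∷ []
constant {suc m} k = 0ℤ ∷ constant k

variableᵃ : Fin m → Affine m
variableᵃ zero    = 1ℤ ∷ constant 0ℤ
variableᵃ (suc i) = 0ℤ ∷ variableᵃ i

⊕-homo : ∀ (u v : Affine m) a → ⟦ u ⊕ v ⟧ᵃ a ≡ ⟦ u ⟧ᵃ a + ⟦ v ⟧ᵃ a
⊕-homo (_ ∷ _) (_ ∷ _) [] = refl
⊕-homo (c ∷ u) (d ∷ v) (y ∷ a) =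
  trans (cong (λ z → (c + d) * y + z) (⊕-homo u v a)) (lemma c d y (⟦ u ⟧ᵃ a) (⟦ v ⟧ᵃ a))
  where
  lemma : ∀ c d y s t → (c + d) * y + (s + t) ≡ c * y + s + (d * y + t)
  lemma = solve-∀

⊛-homo : ∀ k (u : Affine m) a → ⟦ k ⊛ u ⟧ᵃ a ≡ k * ⟦ u ⟧ᵃ a
⊛-homo k (_ ∷ _) [] = refl
⊛-homo k (c ∷ u) (y ∷ a) =
  trans (cong (λ z → k * c * y + z) (⊛-homo k u a)) (lemma k c y (⟦ u ⟧ᵃ a))
  where
  lemma : ∀ k c y s → k * c * y + k * s ≡ k * (c * y + s)
  lemma = solve-∀

constant-eval : ∀ k (a : Vec ℤ m) → ⟦ constant k ⟧ᵃ a ≡ k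
constant-eval k []      = refl
constant-eval k (y ∷ a) = trans (ℤ.+-identityˡ _) (constant-eval k a)

variable-eval : ∀ (i : Fin m) a → ⟦ variableᵃ i ⟧ᵃ a ≡ lookup a i
variable-eval zero    (y ∷ a) =
  trans (cong₂ _+_ (ℤ.*-identityˡ y) (constant-eval 0ℤ a)) (ℤ.+-identityʳ y)
variable-eval (suc i) (y ∷ a) = trans (ℤ.+-identityˡ _) (variable-eval i a)

linearise : Term m → Affine m
linearise (var i)  = variableᵃ i
linearise (s +ᵗ t) = linearise s ⊕ linearise t

linearise-eval : ∀ (t : Term m) a → ⟦ linearise t ⟧ᵃ a ≡ ⟦ t ⟧ᵗ a
linearise-eval (var i)  a = variable-eval i a
linearise-eval (s +ᵗ t) a =
  trans (⊕-homo (linearise s) (linearise t) a)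
        (cong₂ _+_ (linearise-eval s a) (linearise-eval t a))

infix 6 0≤_ [1+_]∣_

-- Arbitrary Boolean functions serve as connectives: the arguments below only use that the truth of
-- a compound is determined by that of its two parts, so no normal form is ever computed.
data QF (m : ℕ) : Set where
  ⊥ᵠ      : QF m
  0≤_     : Affine m → QF m
  [1+_]∣_ : ℕ → Affine m → QF m
  connect : (Bool → Bool → Bool) → QF m → QF m → QF m

eval : QF m → Vec ℤ m → Bool
eval ⊥ᵠ                a = false
eval (0≤ u)            a = does (0ℤ ℤ.≤? ⟦ u ⟧ᵃ a)
eval ([1+ d ]∣ u)      a = does (+[1+ d ] ∣? ⟦ u ⟧ᵃ a)
eval (connect _∙_ θ η) a = eval θ a ∙ eval η a

-- (d , u) stands for the rational affine function u / (1 + d).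
Quotient : ℕ → Set
Quotient m = ℕ × Affine m

-- Boundaries and shifts by the period

infix 4 _≐_at_
_≐_at_ : ℤ → Quotient m → Vec ℤ m → Set
y ≐ (d , u) at a = +[1+ d ] * y ≡ ⟦ u ⟧ᵃ a

-- Any common multiple of the moduli will do; the product stays clear of least common multiples.
period : QF m → ℕ
period ([1+ d ]∣ u)    = suc d
period (connect _ θ η) = period θ ℕ.* period η
period _               = 1

period-nonZero : ∀ (θ : QF m) → ℕ.NonZero (period θ)
period-nonZero ⊥ᵠ              = _
period-nonZero (0≤ u)          = _
period-nonZero ([1+ d ]∣ u)    = _
period-nonZero (connect _ θ η) =
  ℕ.m*n≢0 (period θ) (period η) {{period-nonZero θ}} {{period-nonZero η}}

interval : ℕ → List ℤ
interval b = List.map +_ (List.upTo (suc b)) List.++ List.map (λ i → - (+ i)) (List.upTo (suc b))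

∈-interval : ∀ k {b} → ∣ k ∣ ℕ.≤ b → k List.∈ interval b
∈-interval (+ k)     k≤b = List.∈-++⁺ˡ (List.∈-map⁺ +_ (List.∈-upTo⁺ (s≤s k≤b)))
∈-interval -[1+ k ] {b} k≤b =
  List.∈-++⁺ʳ (List.map +_ (List.upTo (suc b)))
    (List.∈-map⁺ (λ i → - (+ i)) (List.∈-upTo⁺ (s≤s k≤b)))

-- The solutions y of ∣ c y + u ∣ ≤ p ∣ c ∣, none being listed when c = 0.
near : ℕ → Affine (suc m) → List (Quotient m)
near p (+ zero    ∷ u) = []
near p (+[1+ d ]  ∷ u) = List.map (λ k → d , constant k ⊕ -1ℤ ⊛ u) (interval (suc d ℕ.* p))
near p (-[1+ d ]  ∷ u) = List.map (λ k → d , constant k ⊕ u) (interval (suc d ℕ.* p))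

-- For c > 0 take k = c y + u(a), which lies in the interval by hypothesis, so that c y = k - u(a).
-- For c < 0 both signs are flipped to keep the denominator positive, and the listed k is - (c y +
-- u(a)).
∈-near : ∀ p c (u : Affine m) y a → c ≢ 0ℤ → ∣ c * y + ⟦ u ⟧ᵃ a ∣ ℕ.≤ ∣ c ∣ ℕ.* p →
         Any (y ≐_at a) (near p (c ∷ u))
∈-near p (+ zero)  u y a c≢0 _ = contradiction refl c≢0
∈-near p +[1+ d ] u y a _ le =
  Any.map⁺ (lose (∈-interval (+[1+ d ] * y + ⟦ u ⟧ᵃ a) le) (sym (begin
    ⟦ constant k ⊕ -1ℤ ⊛ u ⟧ᵃ a  ≡⟨ ⊕-homo (constant k) (-1ℤ ⊛ u) a ⟩
    ⟦ constant k ⟧ᵃ a + ⟦ -1ℤ ⊛ u ⟧ᵃ a ≡⟨ cong₂ _+_ (constant-eval k a) (⊛-homo -1ℤ u a) ⟩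
    k + -1ℤ * ⟦ u ⟧ᵃ a ≡⟨ lemma (+[1+ d ] * y) (⟦ u ⟧ᵃ a) ⟩
    +[1+ d ] * y ∎)))
  where
  open ≡-Reasoning
  k = +[1+ d ] * y + ⟦ u ⟧ᵃ a
  lemma : ∀ s t → s + t + -1ℤ * t ≡ s
  lemma = solve-∀
∈-near p -[1+ d ] u y a _ le =
  Any.map⁺ (lose (∈-interval k (subst (ℕ._≤ suc d ℕ.* p) (sym (ℤ.∣-i∣≡∣i∣ k′)) le)) (sym (begin
    ⟦ constant k ⊕ u ⟧ᵃ a  ≡⟨ ⊕-homo (constant k) u a ⟩
    ⟦ constant k ⟧ᵃ a + ⟦ u ⟧ᵃ a ≡⟨ cong (_+ ⟦ u ⟧ᵃ a) (constant-eval k a) ⟩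
    k + ⟦ u ⟧ᵃ a ≡⟨ lemma +[1+ d ] y (⟦ u ⟧ᵃ a) ⟩
    +[1+ d ] * y ∎)))
  where
  open ≡-Reasoning
  k′ = -[1+ d ] * y + ⟦ u ⟧ᵃ a
  k = - k′
  lemma : ∀ c y t → - (- c * y + t) + t ≡ c * y
  lemma = solve-∀

-- Only inequality atoms matter, divisibility atoms being invariant under shifts by the period.
boundaries : ℕ → QF (suc m) → List (Quotient m)
boundaries p (0≤ u)          = near p u
boundaries p (connect _ θ η) = boundaries p θ List.++ boundaries p η
boundaries p _               = []

-- If w is strictly smaller than v in absolute value, then v is nonzero and v + w falls on the same
-- side of 0.
sign-change : ∀ v w → does (0ℤ ℤ.≤? v + w) ≡ does (0ℤ ℤ.≤? v) ⊎ ∣ v ∣ ℕ.≤ ∣ w ∣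
sign-change v w with ∣ v ∣ ℕ.≤? ∣ w ∣
... | yes v≤w = inj₂ v≤w
... | no  v≰w = inj₁ (same v w (ℕ.≰⇒> v≰w))
  where
  same : ∀ v w → ∣ w ∣ ℕ.< ∣ v ∣ → does (0ℤ ℤ.≤? v + w) ≡ does (0ℤ ℤ.≤? v)
  same (+ v)    (+ w)    _ = refl
  same (+ v)    -[1+ w ] w<v rewrite ℤ.⊖-≥ (ℕ.<⇒≤ w<v) = refl
  same -[1+ v ] (+ w)    w<v rewrite ℤ.⊖-< w<v with suc v ℕ.∸ w | ℕ.m<n⇒0<n∸m w<v
  ... | suc _ | _ = refl
  same -[1+ v ] -[1+ w ] _ = refl

shift-∣ : ∀ {d} v w → d ∣ w → does (d ∣? v + w) ≡ does (d ∣? v)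
shift-∣ {d} v w d∣w = does-⇔ (mk⇔ (λ h → ∣m+n∣n⇒∣m h d∣w) (λ h → ∣m∣n⇒∣m+n h d∣w)) (d ∣? v + w) (d ∣? v)

shift-affine : ∀ c y s t → c * (y + s) + t ≡ c * y + t + c * s
shift-affine = solve-∀

-- Moving y by s adds c s to an atom c y + u. Divisibility does not see this, as the modulus divides
-- s; an inequality can flip only if c y + u is at most p times c in absolute value, and then `near`
-- lists y. The step length p is kept apart from `period θ` so that the induction can pass to
-- subformulas, whose periods divide p.
shift : ∀ (θ : QF (suc m)) y s a p → ∣ s ∣ ≡ p → period θ ℕ∣.∣ p →
        eval θ (y + s ∷ a) ≡ eval θ (y ∷ a) ⊎ Any (y ≐_at a) (boundaries p θ)
shift ⊥ᵠ y s a p eq _ = inj₁ refl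
shift (0≤ (c ∷ u)) y s a p eq _ rewrite shift-affine c y s (⟦ u ⟧ᵃ a) with c ℤ.≟ 0ℤ
-- For c = 0 the atom does not depend on y.
... | yes refl = inj₁ (cong (λ t → does (0ℤ ℤ.≤? t)) (ℤ.+-identityʳ (0ℤ + ⟦ u ⟧ᵃ a)))
... | no c≢0 = Sum.map₂
  (∈-near p c u y a c≢0 ∘ subst (_ ℕ.≤_) (trans (ℤ.abs-* c s) (cong (∣ c ∣ ℕ.*_) eq)))
  (sign-change (c * y + ⟦ u ⟧ᵃ a) (c * s))
shift ([1+ d ]∣ (c ∷ u)) y s a p refl d∣p rewrite shift-affine c y s (⟦ u ⟧ᵃ a) =
  inj₁ (shift-∣ {+[1+ d ]} (c * y + ⟦ u ⟧ᵃ a) (c * s) (∣n⇒∣m*n c (∣ᵤ⇒∣ d∣p)))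
shift (connect _∙_ θ η) y s a p eq ∣p
  with shift θ y s a p eq (ℕ∣.m*n∣⇒m∣ (period θ) (period η) ∣p)
     | shift η y s a p eq (ℕ∣.m*n∣⇒n∣ (period θ) (period η) ∣p)
... | inj₁ e | inj₁ f = inj₁ (cong₂ _∙_ e f)
... | inj₂ b | _      = inj₂ (Any.++⁺ˡ b)
... | inj₁ _ | inj₂ b = inj₂ (Any.++⁺ʳ (boundaries p θ) b)

-- If θ had no boundary at y, then y + period would be a second solution.
functional-boundary : ∀ (θ : QF (suc m)) a →
  (∀ {y y′} → T (eval θ (y ∷ a)) → T (eval θ (y′ ∷ a)) → y ≡ y′) →
  ∀ y → T (eval θ (y ∷ a)) → Any (y ≐_at a) (boundaries (period θ) θ)
functional-boundary θ a unique y θy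
  with shift θ y (+ period θ) a (period θ) refl ℕ∣.∣-refl
... | inj₂ b = b
... | inj₁ e = contradiction
  (ℤ.+-injective (identityʳ-unique y _ (unique (subst T (sym e) θy) θy)))
  (ℕ.≢-nonZero⁻¹ (period θ) {{period-nonZero θ}})

-- Applied to the form y itself, `near` yields the constants of absolute value at most the period,
-- where the walk towards 0 stops.
candidates : QF (suc m) → List (Quotient m)
candidates θ = near (period θ) (1ℤ ∷ constant 0ℤ) List.++ boundaries (period θ) θ

-- Moving towards 0 in steps of the period, the truth of θ can only be lost at a boundary.
complete : ∀ (θ : QF (suc m)) a y → T (eval θ (y ∷ a)) →
           ∃ λ z → T (eval θ (z ∷ a)) × Any (z ≐_at a) (candidates θ)
complete {m} θ a y = descend y (<-wellFounded ∣ y ∣)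
  where
  p = period θ
  p>0 : 0 ℕ.< p
  p>0 = ℕ.>-nonZero⁻¹ p {{period-nonZero θ}}

  step : ∀ y → p ℕ.< ∣ y ∣ → ∃ λ s → ∣ s ∣ ≡ p × ∣ y + s ∣ ℕ.< ∣ y ∣
  step (+ y) p<y = - (+ p) , ℤ.∣-i∣≡∣i∣ (+ p) ,
    subst (ℕ._< y) (sym (trans (cong ∣_∣ (ℤ.m-n≡m⊖n y p)) (cong ∣_∣ (ℤ.⊖-≥ (ℕ.<⇒≤ p<y)))))
      (ℕ.∸-monoʳ-< p>0 (ℕ.<⇒≤ p<y))
  step -[1+ y ] p<y = + p , refl ,
    subst (ℕ._< suc y) (sym (ℤ.∣⊖∣-≤ (ℕ.<⇒≤ p<y)))
      (ℕ.∸-monoʳ-< p>0 (ℕ.<⇒≤ p<y))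

  descend : ∀ y → Acc ℕ._<_ ∣ y ∣ → T (eval θ (y ∷ a)) →
            ∃ λ z → T (eval θ (z ∷ a)) × Any (z ≐_at a) (candidates θ)
  descend y (acc rec) θy with ∣ y ∣ ℕ.≤? p
  ... | yes y≤p = y , θy , Any.++⁺ˡ (∈-near p 1ℤ (constant 0ℤ) y a (λ ()) 
          (subst (ℕ._≤ 1 ℕ.* p) (sym (cong ∣_∣ (variable-eval zero (y ∷ a))))
          (subst (∣ y ∣ ℕ.≤_) (sym (ℕ.*-identityˡ p)) y≤p)))
  ... | no  y≰p with step y (ℕ.≰⇒> y≰p)
  ...   | s , ∣s∣≡p , closer with shift θ y s a p ∣s∣≡p ℕ∣.∣-refl
  ...     | inj₁ e = descend (y + s) (rec closer) (subst T (sym e) θy)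
  -- The boundary lies at the point before the step, where θ still holds, so y itself is the
  -- witness.
  ...     | inj₂ b = y , θy , Any.++⁺ʳ (near p (1ℤ ∷ constant 0ℤ)) b

-- Atoms are scaled by 1 + d to clear the denominator.
substitute : Quotient m → QF (suc m) → QF m
substitute (d , u) ⊥ᵠ                 = ⊥ᵠ
substitute (d , u) (0≤ (e ∷ t))       = 0≤ (e ⊛ u ⊕ +[1+ d ] ⊛ t)
substitute (d , u) ([1+ k ]∣ (e ∷ t)) = [1+ k ℕ.+ d ℕ.* suc k ]∣ (e ⊛ u ⊕ +[1+ d ] ⊛ t)
substitute σ (connect _∙_ θ η)        = connect _∙_ (substitute σ θ) (substitute σ η)

substitute-affine : ∀ d (u : Affine m) e t {y a} → y ≐ (d , u) at a →
  ⟦ e ⊛ u ⊕ +[1+ d ] ⊛ t ⟧ᵃ a ≡ +[1+ d ] * (e * y + ⟦ t ⟧ᵃ a)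
substitute-affine d u e t {y} {a} eq = begin
  ⟦ e ⊛ u ⊕ D ⊛ t ⟧ᵃ a         ≡⟨ ⊕-homo (e ⊛ u) (D ⊛ t) a ⟩
  ⟦ e ⊛ u ⟧ᵃ a + ⟦ D ⊛ t ⟧ᵃ a  ≡⟨ cong₂ _+_ (⊛-homo e u a) (⊛-homo D t a) ⟩
  e * ⟦ u ⟧ᵃ a + D * ⟦ t ⟧ᵃ a  ≡⟨ cong (λ v → e * v + D * ⟦ t ⟧ᵃ a) eq ⟨
  e * (D * y) + D * ⟦ t ⟧ᵃ a   ≡⟨ lemma e D y (⟦ t ⟧ᵃ a) ⟩
  D * (e * y + ⟦ t ⟧ᵃ a)       ∎
  where
  open ≡-Reasoning
  D = +[1+ d ]
  lemma : ∀ e d y t → e * (d * y) + d * t ≡ d * (e * y + t)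
  lemma = solve-∀

scale-≤ : ∀ d v → does (0ℤ ℤ.≤? +[1+ d ] * v) ≡ does (0ℤ ℤ.≤? v)
scale-≤ d (+ zero)   rewrite ℕ.*-zeroʳ d = refl
scale-≤ d +[1+ v ] = refl
scale-≤ d -[1+ v ] = refl

-- The product of the two positive integers computes to the modulus that `substitute` writes, 1 + (k
-- + d (1 + k)).
scale-∣ : ∀ d k v → does (+[1+ d ] * +[1+ k ] ∣? +[1+ d ] * v) ≡ does (+[1+ k ] ∣? v)
scale-∣ d k v = does-⇔ (mk⇔ (*-cancelˡ-∣ +[1+ d ]) (*-monoʳ-∣ +[1+ d ]))
  (+[1+ d ] * +[1+ k ] ∣? +[1+ d ] * v) (+[1+ k ] ∣? v)

substitute-eval : ∀ σ (θ : QF (suc m)) {y a} → y ≐ σ at a → eval (substitute σ θ) a ≡ eval θ (y ∷ a)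
substitute-eval σ ⊥ᵠ eq = refl
substitute-eval (d , u) (0≤ (e ∷ t)) {y} {a} eq rewrite substitute-affine d u e t eq =
  scale-≤ d (e * y + ⟦ t ⟧ᵃ a)
substitute-eval (d , u) ([1+ k ]∣ (e ∷ t)) {y} {a} eq rewrite substitute-affine d u e t eq =
  scale-∣ d k (e * y + ⟦ t ⟧ᵃ a)
substitute-eval σ (connect _∙_ θ η) eq = cong₂ _∙_ (substitute-eval σ θ eq) (substitute-eval σ η eq)

-- The divisibility conjunct makes u(a) / (1 + d) an integer; otherwise the substituted formula
-- could hold at a fraction and yield no witness in ℤ.
instantiate : QF (suc m) → Quotient m → QF m
instantiate θ σ@(d , u) = connect _∧_ ([1+ d ]∣ u) (substitute σ θ)

disjunction : List (QF m) → QF m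
disjunction = List.foldr (connect _∨_) ⊥ᵠ

disjunction-sound : ∀ (θs : List (QF m)) {a} → T (eval (disjunction θs) a) → Any (λ θ → T (eval θ a)) θs
disjunction-sound (θ ∷ θs) {a} h with to (T-∨ {eval θ a}) h
... | inj₁ t = here t
... | inj₂ t = there (disjunction-sound θs t)

disjunction-complete : ∀ {θs : List (QF m)} {a} →
  Any (λ θ → T (eval θ a)) θs → T (eval (disjunction θs) a)
disjunction-complete {a = a} (here {θ} t)  = from (T-∨ {eval θ a}) (inj₁ t)
disjunction-complete {a = a} (there {θ} t) = from (T-∨ {eval θ a}) (inj₂ (disjunction-complete t))

eliminate : QF (suc m) → QF m
eliminate θ = disjunction (List.map (instantiate θ) (candidates θ))

T⇒ : ∀ {ℓ} {P : Set ℓ} {b} → Reflects P b → T b → P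
T⇒ (ofʸ p) _ = p

⇒T : ∀ {ℓ} {P : Set ℓ} {b} → Reflects P b → P → T b
⇒T (ofʸ _) _ = tt
⇒T (ofⁿ ¬p) p = ¬p p

instantiate-sound : ∀ (θ : QF (suc m)) σ {a} → T (eval (instantiate θ σ) a) → ∃ λ y → T (eval θ (y ∷ a))
instantiate-sound θ σ@(d , u) {a} h with to T-∧ h
... | d∣u , θσ with T⇒ (proof (+[1+ d ] ∣? ⟦ u ⟧ᵃ a)) d∣u
...   | divides y eq = y , subst T (substitute-eval σ θ (trans (ℤ.*-comm +[1+ d ] y) (sym eq))) θσ

instantiate-complete : ∀ (θ : QF (suc m)) σ {a y} →
  T (eval θ (y ∷ a)) → y ≐ σ at a → T (eval (instantiate θ σ) a)
instantiate-complete θ σ@(d , u) {a} {y} θy eq = from T-∧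
  ( ⇒T (proof (+[1+ d ] ∣? ⟦ u ⟧ᵃ a)) (divides y (trans (sym eq) (ℤ.*-comm +[1+ d ] y)))
  , subst T (sym (substitute-eval σ θ eq)) θy)

-- Completeness trades the given solution y for the possibly different z found by `complete`, which
-- is the value of a candidate.
eliminate-reflects : ∀ (θ : QF (suc m)) a → Reflects (∃ λ y → T (eval θ (y ∷ a))) (eval (eliminate θ) a)
eliminate-reflects θ a = fromEquivalence
  (λ h → case Any.satisfied (Any.map⁻ (disjunction-sound (List.map (instantiate θ) (candidates θ)) h)) of
     λ (σ , t) → instantiate-sound θ σ t)
  (λ (y , θy) → case complete θ a y θy of λ (z , θz , z∈) →
     disjunction-complete (Any.map⁺ (Any.map (instantiate-complete θ _ θz) z∈)))

-- Translation of formulas and decidability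

infix 6 _≤ᵠ_
_≤ᵠ_ : Term m → Term m → QF m
s ≤ᵠ t = 0≤ (linearise t ⊕ -1ℤ ⊛ linearise s)

negate : QF m → QF m
negate θ = connect (λ b _ → not b) θ θ

quantifier-free : Formula m → QF m
quantifier-free (s ≤ᶠ t) = s ≤ᵠ t
quantifier-free (s ≡ᶠ t) = connect _∧_ (s ≤ᵠ t) (t ≤ᵠ s)
quantifier-free (¬ᶠ φ)   = negate (quantifier-free φ)
quantifier-free (φ ∧ᶠ ψ) = connect _∧_ (quantifier-free φ) (quantifier-free ψ)
quantifier-free (φ ∨ᶠ ψ) = connect _∨_ (quantifier-free φ) (quantifier-free ψ)
quantifier-free (φ ⇒ᶠ ψ) = connect (λ b c → not b ∨ c) (quantifier-free φ) (quantifier-free ψ)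
quantifier-free (∀ᶠ φ)   = negate (eliminate (negate (quantifier-free φ)))
quantifier-free (∃ᶠ φ)   = eliminate (quantifier-free φ)

mapʳ : ∀ {p q} {P : Set p} {Q : Set q} {b} → (P → Q) → (Q → P) → Reflects P b → Reflects Q b
mapʳ f g r = proof (map′ f g (_ because r))

≤ᵠ-reflects : ∀ (s t : Term m) a → Reflects (⟦ s ⟧ᵗ a ℤ.≤ ⟦ t ⟧ᵗ a) (eval (s ≤ᵠ t) a)
≤ᵠ-reflects s t a = subst (λ v → Reflects (⟦ s ⟧ᵗ a ℤ.≤ ⟦ t ⟧ᵗ a) (does (0ℤ ℤ.≤? v))) (sym difference)
  (mapʳ (ℤ.0≤i-j⇒j≤i {⟦ t ⟧ᵗ a}) (ℤ.i≤j⇒0≤j-i {⟦ s ⟧ᵗ a} {⟦ t ⟧ᵗ a})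
    (proof (0ℤ ℤ.≤? ⟦ t ⟧ᵗ a ℤ.- ⟦ s ⟧ᵗ a)))
  where
  open ≡-Reasoning
  difference : ⟦ linearise t ⊕ -1ℤ ⊛ linearise s ⟧ᵃ a ≡ ⟦ t ⟧ᵗ a ℤ.- ⟦ s ⟧ᵗ a
  difference = begin
    ⟦ linearise t ⊕ -1ℤ ⊛ linearise s ⟧ᵃ a          ≡⟨ ⊕-homo (linearise t) (-1ℤ ⊛ linearise s) a ⟩
    ⟦ linearise t ⟧ᵃ a + ⟦ -1ℤ ⊛ linearise s ⟧ᵃ a
      ≡⟨ cong (λ z → ⟦ linearise t ⟧ᵃ a + z) (⊛-homo -1ℤ (linearise s) a) ⟩
    ⟦ linearise t ⟧ᵃ a + -1ℤ * ⟦ linearise s ⟧ᵃ a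
      ≡⟨ cong₂ (λ x y → x + -1ℤ * y) (linearise-eval t a) (linearise-eval s a) ⟩
    ⟦ t ⟧ᵗ a + -1ℤ * ⟦ s ⟧ᵗ a                       ≡⟨ cong (λ z → ⟦ t ⟧ᵗ a + z) (ℤ.-1*i≡-i (⟦ s ⟧ᵗ a)) ⟩
    ⟦ t ⟧ᵗ a ℤ.- ⟦ s ⟧ᵗ a                           ∎

quantifier-free-reflects : ∀ (φ : Formula m) a → Reflects (a ⊨ φ) (eval (quantifier-free φ) a)
quantifier-free-reflects (s ≤ᶠ t) a = ≤ᵠ-reflects s t a
quantifier-free-reflects (s ≡ᶠ t) a =
  mapʳ (λ (p , q) → ℤ.≤-antisym p q) (λ eq → ℤ.≤-reflexive eq , ℤ.≤-reflexive (sym eq))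
    (≤ᵠ-reflects s t a ×-reflects ≤ᵠ-reflects t s a)
quantifier-free-reflects (¬ᶠ φ)   a = ¬-reflects (quantifier-free-reflects φ a)
quantifier-free-reflects (φ ∧ᶠ ψ) a = quantifier-free-reflects φ a ×-reflects quantifier-free-reflects ψ a
quantifier-free-reflects (φ ∨ᶠ ψ) a = quantifier-free-reflects φ a ⊎-reflects quantifier-free-reflects ψ a
quantifier-free-reflects (φ ⇒ᶠ ψ) a = quantifier-free-reflects φ a →-reflects quantifier-free-reflects ψ a
quantifier-free-reflects (∀ᶠ φ)   a =
  -- Absence of counterexamples gives only a double negation at y; since φ is decided there, it can
  -- be removed.
  mapʳ (λ none y → by-cases (quantifier-free-reflects φ (y ∷ a)) (λ t → none (y , t)))
       (λ all (y , t) → T⇒ (¬-reflects (quantifier-free-reflects φ (y ∷ a))) t (all y))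
    (¬-reflects (eliminate-reflects (negate (quantifier-free φ)) a))
  where
  by-cases : ∀ {ℓ} {P : Set ℓ} {b} → Reflects P b → ¬ T (not b) → P
  by-cases (ofʸ p) _ = p
  by-cases (ofⁿ _) h = contradiction tt h
quantifier-free-reflects (∃ᶠ φ)   a =
  mapʳ (λ (y , t) → y , T⇒ (quantifier-free-reflects φ (y ∷ a)) t)
       (λ (y , h) → y , ⇒T (quantifier-free-reflects φ (y ∷ a)) h)
    (eliminate-reflects (quantifier-free φ) a)

_⊨?_ : ∀ (a : Vec ℤ m) φ → Dec (a ⊨ φ)
a ⊨? φ = eval (quantifier-free φ) a because quantifier-free-reflects φ a

-- Definable relations

Σ-⇔ : ∀ {a b c} {A : Set a} {B : A → Set b} {C : A → Set c} → (∀ x → B x ⇔ C x) → ∃ B ⇔ ∃ C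
Σ-⇔ h = mk⇔ (Product.map₂ (to (h _))) (Product.map₂ (from (h _)))

Π-⇔ : ∀ {a b c} {A : Set a} {B : A → Set b} {C : A → Set c} →
      (∀ x → B x ⇔ C x) → (∀ x → B x) ⇔ (∀ x → C x)
Π-⇔ h = mk⇔ (λ f x → to (h x) (f x)) (λ f x → from (h x) (f x))

≡-⇔ : ∀ {p} {P : Set p} {Q} → P ≡ Q → P ⇔ Q
≡-⇔ refl = mk⇔ (λ p → p) (λ p → p)

renameᵗ : (Fin m → Fin n) → Term m → Term n
renameᵗ ρ (var i)  = var (ρ i)
renameᵗ ρ (s +ᵗ t) = renameᵗ ρ s +ᵗ renameᵗ ρ t

rename : (Fin m → Fin n) → Formula m → Formula n
rename ρ (s ≤ᶠ t) = renameᵗ ρ s ≤ᶠ renameᵗ ρ t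
rename ρ (s ≡ᶠ t) = renameᵗ ρ s ≡ᶠ renameᵗ ρ t
rename ρ (¬ᶠ φ)   = ¬ᶠ rename ρ φ
rename ρ (φ ∧ᶠ ψ) = rename ρ φ ∧ᶠ rename ρ ψ
rename ρ (φ ∨ᶠ ψ) = rename ρ φ ∨ᶠ rename ρ ψ
rename ρ (φ ⇒ᶠ ψ) = rename ρ φ ⇒ᶠ rename ρ ψ
rename ρ (∀ᶠ φ)   = ∀ᶠ rename (Fin.lift 1 ρ) φ
rename ρ (∃ᶠ φ)   = ∃ᶠ rename (Fin.lift 1 ρ) φ

Renames : (Fin m → Fin n) → Vec ℤ m → Vec ℤ n → Set
Renames ρ a b = ∀ i → lookup a i ≡ lookup b (ρ i)

renames-lift : ∀ {ρ : Fin m → Fin n} {a b} → Renames ρ a b → ∀ z → Renames (Fin.lift 1 ρ) (z ∷ a) (z ∷ b)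
renames-lift h z zero    = refl
renames-lift h z (suc i) = h i

renameᵗ-eval : ∀ {ρ : Fin m → Fin n} {a b} → Renames ρ a b → ∀ t → ⟦ t ⟧ᵗ a ≡ ⟦ renameᵗ ρ t ⟧ᵗ b
renameᵗ-eval h (var i)  = h i
renameᵗ-eval h (s +ᵗ t) = cong₂ _+_ (renameᵗ-eval h s) (renameᵗ-eval h t)

rename-⊨ : ∀ {ρ : Fin m → Fin n} {a b} → Renames ρ a b → ∀ φ → (a ⊨ φ) ⇔ (b ⊨ rename ρ φ)
rename-⊨ h (s ≤ᶠ t) = ≡-⇔ (cong₂ ℤ._≤_ (renameᵗ-eval h s) (renameᵗ-eval h t))
rename-⊨ h (s ≡ᶠ t) = ≡-⇔ (cong₂ _≡_ (renameᵗ-eval h s) (renameᵗ-eval h t))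
rename-⊨ h (¬ᶠ φ)   = ¬-cong-⇔ (rename-⊨ h φ)
rename-⊨ h (φ ∧ᶠ ψ) = rename-⊨ h φ ×-⇔ rename-⊨ h ψ
rename-⊨ h (φ ∨ᶠ ψ) = rename-⊨ h φ ⊎-⇔ rename-⊨ h ψ
rename-⊨ h (φ ⇒ᶠ ψ) = →-cong-⇔ (rename-⊨ h φ) (rename-⊨ h ψ)
rename-⊨ h (∀ᶠ φ)   = Π-⇔ λ z → rename-⊨ (renames-lift h z) φ
rename-⊨ h (∃ᶠ φ)   = Σ-⇔ λ z → rename-⊨ (renames-lift h z) φ

∃ˡ : ∀ k → Formula (k ℕ.+ m) → Formula m
∃ˡ zero    φ = φ
∃ˡ (suc k) φ = ∃ˡ k (∃ᶠ φ)

∃ˡ-⊨ : ∀ k (φ : Formula (k ℕ.+ m)) a → (a ⊨ ∃ˡ k φ) ⇔ ∃ λ b → b ++ a ⊨ φ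
∃ˡ-⊨ zero    φ a = mk⇔ (λ h → [] , h) (λ { ([] , h) → h })
∃ˡ-⊨ (suc k) φ a = mk⇔
  (λ h → case to (∃ˡ-⊨ k (∃ᶠ φ) a) h of λ (b , z , h′) → z ∷ b , h′)
  (λ { (z ∷ b , h) → from (∃ˡ-⊨ k (∃ᶠ φ) a) (b , z , h) })

-- In a graph the outputs follow the inputs, whereas quantifiers bind from the front; the two blocks
-- are exchanged before outputs are quantified away.
swap : ∀ n q → Fin (n ℕ.+ q) → Fin (q ℕ.+ n)
swap n q = [ q ↑ʳ_ , _↑ˡ n ]′ ∘ splitAt n

swap-renames : ∀ (a : Vec ℤ n) (b : Vec ℤ q) → Renames (swap n q) (a ++ b) (b ++ a)
swap-renames {n} a b i with splitAt n i | Vec.lookup-splitAt n a b i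
... | inj₁ j | eq = trans eq (sym (Vec.lookup-++ʳ b a j))
... | inj₂ j | eq = trans eq (sym (Vec.lookup-++ˡ b a j))

∃ʳ : ∀ q → Formula (n ℕ.+ q) → Formula n
∃ʳ q φ = ∃ˡ q (rename (swap _ q) φ)

∃ʳ-⊨ : ∀ q (φ : Formula (n ℕ.+ q)) a → (a ⊨ ∃ʳ q φ) ⇔ ∃ λ b → a ++ b ⊨ φ
∃ʳ-⊨ q φ a = mk⇔
  (λ h → case to (∃ˡ-⊨ q _ a) h of λ (b , h′) → b , from (rename-⊨ (swap-renames a b) φ) h′)
  (λ (b , h) → from (∃ˡ-⊨ q _ a) (b , to (rename-⊨ (swap-renames a b) φ) h))

-- Reading m as 0 + m, all variables are quantified away, and the resulting sentence is decided at
-- the empty tuple.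
satisfiable? : (φ : Formula m) → Dec (∃ λ a → a ⊨ φ)
satisfiable? {m} φ = Decidable.map (∃ʳ-⊨ m φ []) ([] ⊨? ∃ʳ m φ)

-- There are no closed terms, so with m = 0 an atom can only occur under a quantifier.
⊤ᶠ : Formula m
⊤ᶠ = ∀ᶠ (var zero ≡ᶠ var zero)

⋀ : (Fin q → Formula m) → Formula m
⋀ {zero}  φ = ⊤ᶠ
⋀ {suc q} φ = φ zero ∧ᶠ ⋀ (φ ∘ suc)

⋀-⊨ : ∀ (φ : Fin q → Formula m) a → (a ⊨ ⋀ φ) ⇔ (∀ i → a ⊨ φ i)
⋀-⊨ {zero}  φ a = mk⇔ (λ _ ()) (λ _ _ → refl)
⋀-⊨ {suc q} φ a = mk⇔
  (λ { (h , _) zero → h ; (_ , h) (suc i) → to (⋀-⊨ (φ ∘ suc) a) h i })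
  (λ h → h zero , from (⋀-⊨ (φ ∘ suc) a) (h ∘ suc))

⋁ : (Fin q → Formula m) → Formula m
⋁ {zero}  φ = ¬ᶠ ⊤ᶠ
⋁ {suc q} φ = φ zero ∨ᶠ ⋁ (φ ∘ suc)

⋁-⊨ : ∀ (φ : Fin q → Formula m) a → (a ⊨ ⋁ φ) ⇔ (∃ λ i → a ⊨ φ i)
⋁-⊨ {zero}  φ a = mk⇔ (λ h → contradiction (λ _ → refl) h) (λ ())
⋁-⊨ {suc q} φ a = mk⇔
  (λ { (inj₁ h) → zero , h ; (inj₂ h) → Product.map suc (λ h′ → h′) (to (⋁-⊨ (φ ∘ suc) a) h) })
  (λ { (zero , h) → inj₁ h ; (suc i , h) → inj₂ (from (⋁-⊨ (φ ∘ suc) a) (i , h)) })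

-- The signature has no constant 0; z + z ≤ z expresses z ≤ 0.
positiveᶠ : Fin m → Formula m
positiveᶠ i = ¬ᶠ (var i +ᵗ var i ≤ᶠ var i)

positive-⊨ : ∀ (a : Vec ℤ m) i → (a ⊨ positiveᶠ i) ⇔ ℤ.Positive (lookup a i)
positive-⊨ a i = lemma (lookup a i)
  where
  lemma : ∀ z → (¬ (z + z ℤ.≤ z)) ⇔ ℤ.Positive z
  lemma +[1+ z ] = mk⇔ _ (λ _ h → ℕ.<-irrefl refl
    (ℕ.≤-trans (ℕ.m<m+n (suc z) (s≤s z≤n)) (ℤ.drop‿+≤+ h)))
  lemma (+ zero)  = mk⇔ (λ h → contradiction ℤ.≤-refl h) λ ()
  lemma -[1+ z ]  = mk⇔ (λ h → contradiction (ℤ.-≤- (ℕ.m≤n⇒m≤1+n (ℕ.m≤m+n z z))) h) λ ()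

-- 1 is the least positive integer.
oneᶠ : Fin m → Formula m
oneᶠ i = positiveᶠ i ∧ᶠ ∀ᶠ (positiveᶠ zero ⇒ᶠ var (suc i) ≤ᶠ var zero)

one-⊨ : ∀ (a : Vec ℤ m) i → (a ⊨ oneᶠ i) ⇔ (lookup a i ≡ 1ℤ)
one-⊨ a i = mk⇔
  (λ (pos , least) → lemma (lookup a i) (to (positive-⊨ a i) pos)
                           (least 1ℤ (from (positive-⊨ (1ℤ ∷ a) zero) _)))
  (λ eq → from (positive-⊨ a i) (subst ℤ.Positive (sym eq) _) ,
          λ z pos → subst (ℤ._≤ z) (sym eq) (least z (to (positive-⊨ (z ∷ a) zero) pos)))
  where
  lemma : ∀ z → ℤ.Positive z → z ℤ.≤ 1ℤ → z ≡ 1ℤ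
  lemma +[1+ zero ] _ _ = refl
  lemma +[1+ suc z ] _ (ℤ.+≤+ (s≤s ()))
  least : ∀ z → ℤ.Positive z → 1ℤ ℤ.≤ z
  least +[1+ z ] _ = ℤ.+≤+ (s≤s z≤n)

-- No term denotes 0 throughout, so a multiple of a variable is always added to a given term t.
times : ℕ → Fin m → Term m → Term m
times zero    i t = t
times (suc k) i t = var i +ᵗ times k i t

times-eval : ∀ k (i : Fin m) t a → ⟦ times k i t ⟧ᵗ a ≡ + k * lookup a i + ⟦ t ⟧ᵗ a
times-eval zero    i t a = sym (ℤ.+-identityˡ _)
times-eval (suc k) i t a =
  trans (cong (λ z → lookup a i + z) (times-eval k i t a)) (lemma (+ k) (lookup a i) (⟦ t ⟧ᵗ a))
  where
  lemma : ∀ k x t → x + (k * x + t) ≡ (1ℤ + k) * x + t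
  lemma = solve-∀

-- Terms have neither subtraction nor negative coefficients, so an equation u = 0 is written with
-- the positive coefficients on one side and the negated negative ones on the other.
positive-part negative-part : ℤ → ℕ
positive-part (+ k)     = k
positive-part -[1+ k ]  = 0
negative-part (+ k)     = 0
negative-part -[1+ k ]  = suc k

parts : ∀ c → + positive-part c ≡ + negative-part c + c
parts (+ k)    = sym (ℤ.+-identityˡ _)
parts -[1+ k ] = sym (ℤ.+-inverseʳ +[1+ k ])

-- The variable e stands for 1; it is added once more since terms cannot be empty.
side : (ℤ → ℕ) → Affine m → (Fin m → Fin n) → Fin n → Term n
side {zero}  part (k ∷ _) ρ e = times (part k) e (var e)
side {suc m} part (c ∷ u) ρ e = times (part c) (ρ zero) (side part u (ρ ∘ suc) e)

-- Coefficient by coefficient the sides differ by c, by `parts`; the extra 1 occurs on both sides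
-- and cancels.
side-balance : ∀ (u : Affine m) {ρ : Fin m → Fin n} {e a b} → Renames ρ a b → lookup b e ≡ 1ℤ →
  ⟦ side positive-part u ρ e ⟧ᵗ b ≡ ⟦ side negative-part u ρ e ⟧ᵗ b + ⟦ u ⟧ᵃ a
side-balance (k ∷ []) {ρ} {e} {[]} {b} h e≡1 = begin
  ⟦ times (positive-part k) e (var e) ⟧ᵗ b          ≡⟨ times-eval (positive-part k) e (var e) b ⟩
  + positive-part k * lookup b e + lookup b e        ≡⟨ cong (λ p → p * lookup b e + lookup b e) (parts k) ⟩
  (+ negative-part k + k) * lookup b e + lookup b e  ≡⟨ cong (λ z → (+ negative-part k + k) * z + z) e≡1 ⟩
  (+ negative-part k + k) * 1ℤ + 1ℤ                  ≡⟨ lemma (+ negative-part k) k ⟩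
  + negative-part k * 1ℤ + 1ℤ + k                    ≡⟨ cong (λ z → + negative-part k * z + z + k) e≡1 ⟨
  + negative-part k * lookup b e + lookup b e + k
    ≡⟨ cong (λ z → z + k) (times-eval (negative-part k) e (var e) b) ⟨
  ⟦ times (negative-part k) e (var e) ⟧ᵗ b + k       ∎
  where
  open ≡-Reasoning
  lemma : ∀ p k → (p + k) * 1ℤ + 1ℤ ≡ p * 1ℤ + 1ℤ + k
  lemma = solve-∀
side-balance (c ∷ u) {ρ} {e} {y ∷ a} {b} h e≡1 = begin
  ⟦ times (positive-part c) (ρ zero) P ⟧ᵗ b          ≡⟨ times-eval (positive-part c) (ρ zero) P b ⟩
  + positive-part c * lookup b (ρ zero) + ⟦ P ⟧ᵗ b
    ≡⟨ cong₂ (λ p z → p * lookup b (ρ zero) + z) (parts c) (side-balance u (h ∘ suc) e≡1) ⟩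
  (+ negative-part c + c) * lookup b (ρ zero) + (⟦ N ⟧ᵗ b + ⟦ u ⟧ᵃ a)
    ≡⟨ lemma (+ negative-part c) c (lookup b (ρ zero)) (⟦ N ⟧ᵗ b) (⟦ u ⟧ᵃ a) ⟩
  + negative-part c * lookup b (ρ zero) + ⟦ N ⟧ᵗ b + (c * lookup b (ρ zero) + ⟦ u ⟧ᵃ a)
    ≡⟨ cong₂ (λ s z → s + (c * z + ⟦ u ⟧ᵃ a)) (times-eval (negative-part c) (ρ zero) N b) (h zero) ⟨
  ⟦ times (negative-part c) (ρ zero) N ⟧ᵗ b + (c * y + ⟦ u ⟧ᵃ a)  ∎
  where
  open ≡-Reasoning
  P = side positive-part u (ρ ∘ suc) e
  N = side negative-part u (ρ ∘ suc) e
  lemma : ∀ p c x n u → (p + c) * x + (n + u) ≡ p * x + n + (c * x + u)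
  lemma = solve-∀

-- The 1 that carries the constant coefficient is supplied by a bound variable which `oneᶠ` pins
-- down.
vanishesᶠ : Affine m → Formula m
vanishesᶠ u = ∃ᶠ (oneᶠ zero ∧ᶠ side positive-part u suc zero ≡ᶠ side negative-part u suc zero)

vanishes-⊨ : ∀ (u : Affine m) a → (a ⊨ vanishesᶠ u) ⇔ (⟦ u ⟧ᵃ a ≡ 0ℤ)
vanishes-⊨ u a = mk⇔
  (λ (e , one , eq) → identityʳ-unique _ _
    (trans (sym (side-balance u (λ _ → refl) (to (one-⊨ (e ∷ a) zero) one))) eq))
  (λ eq → 1ℤ , from (one-⊨ (1ℤ ∷ a) zero) refl ,
          trans (side-balance u (λ _ → refl) refl)
            (trans (cong (λ z → ⟦ side negative-part u suc zero ⟧ᵗ (1ℤ ∷ a) + z) eq) (ℤ.+-identityʳ _)))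

quotientᶠ : Quotient m → Formula (suc m)
quotientᶠ (d , u) = vanishesᶠ (+[1+ d ] ∷ -1ℤ ⊛ u)

quotient-⊨ : ∀ σ y (a : Vec ℤ m) → (y ∷ a ⊨ quotientᶠ σ) ⇔ (y ≐ σ at a)
quotient-⊨ σ@(d , u) y a = mk⇔
  (λ h → ℤ.i-j≡0⇒i≡j (+[1+ d ] * y) (⟦ u ⟧ᵃ a)
    (trans (sym difference) (to (vanishes-⊨ (+[1+ d ] ∷ -1ℤ ⊛ u) (y ∷ a)) h)))
  (λ eq → from (vanishes-⊨ (+[1+ d ] ∷ -1ℤ ⊛ u) (y ∷ a)) (trans difference (ℤ.i≡j⇒i-j≡0 eq)))
  where
  difference : +[1+ d ] * y + ⟦ -1ℤ ⊛ u ⟧ᵃ a ≡ +[1+ d ] * y ℤ.- ⟦ u ⟧ᵃ a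
  difference = cong (λ z → +[1+ d ] * y + z) (trans (⊛-homo -1ℤ u a) (ℤ.-1*i≡-i (⟦ u ⟧ᵃ a)))

-- Graphs of tuples of quotients, and the values of a functional relation

infix 4 _≐*_at_
_≐*_at_ : Vec ℤ q → Vec (Quotient n) q → Vec ℤ n → Set
b ≐* σs at a = Pointwise (λ y σ → y ≐ σ at a) b σs

output : ∀ n → Fin q → Fin (suc n) → Fin (n ℕ.+ q)
output n j zero    = n ↑ʳ j
output {q} n j (suc i) = i ↑ˡ q

output-renames : ∀ (a : Vec ℤ n) (b : Vec ℤ q) j → Renames (output n j) (lookup b j ∷ a) (a ++ b)
output-renames a b j zero    = sym (Vec.lookup-++ʳ a b j)
output-renames a b j (suc i) = sym (Vec.lookup-++ˡ a b i)

graphᶠ : Vec (Quotient n) q → Formula (n ℕ.+ q)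
graphᶠ {n} σs = ⋀ λ j → rename (output n j) (quotientᶠ (lookup σs j))

graph-⊨ : ∀ (σs : Vec (Quotient n) q) a b → (a ++ b ⊨ graphᶠ σs) ⇔ (b ≐* σs at a)
graph-⊨ σs a b = mk⇔
  (λ h → extensional⇒inductive (ext λ j → to (quotient-⊨ (lookup σs j) (lookup b j) a)
           (from (rename-⊨ (output-renames a b j) (quotientᶠ (lookup σs j))) (to (⋀-⊨ _ (a ++ b)) h j))))
  (λ h → from (⋀-⊨ _ (a ++ b)) λ j → to (rename-⊨ (output-renames a b j) (quotientᶠ (lookup σs j)))
           (from (quotient-⊨ (lookup σs j) (lookup b j) a) (Pointwise.lookup h j)))

module _ (n q : ℕ) (φ : Formula (n ℕ.+ q)) where

  Functional : Set
  Functional = ∀ (a : Vec ℤ n) {b b′ : Vec ℤ q} → a ++ b ⊨ φ → a ++ b′ ⊨ φ → b ≡ b′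

  selectᶠ : Fin q → Formula (suc n ℕ.+ q)
  selectᶠ j = rename suc φ ∧ᶠ var zero ≡ᶠ var (suc (n ↑ʳ j))

  -- Elimination handles one variable at a time, so the relation is studied one output coordinate at
  -- a time, with that coordinate y in front.
  componentᶠ : Fin q → Formula (suc n)
  componentᶠ j = ∃ʳ q (selectᶠ j)

  component-⊨ : ∀ j y a → (y ∷ a ⊨ componentᶠ j) ⇔ ∃ λ b → (a ++ b ⊨ φ) × y ≡ lookup b j
  component-⊨ j y a = mk⇔
    (λ h → case to (∃ʳ-⊨ q (selectᶠ j) (y ∷ a)) h of λ (b , φ′ , eq) →
       b , from (rename-⊨ (λ _ → refl) φ) φ′ , trans eq (Vec.lookup-++ʳ a b j))
    (λ (b , φ′ , eq) → from (∃ʳ-⊨ q (selectᶠ j) (y ∷ a))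
       (b , to (rename-⊨ (λ _ → refl) φ) φ′ , trans eq (sym (Vec.lookup-++ʳ a b j))))

  values : Fin q → List (Quotient n)
  values j = boundaries (period θ) θ
    where θ = quantifier-free (componentᶠ j)

  -- Functionality of φ passes to each component relation, so `functional-boundary` places every
  -- value at a boundary.
  value-listed : Functional → ∀ a b → a ++ b ⊨ φ → ∀ j → Any (lookup b j ≐_at a) (values j)
  value-listed unique a b φab j = functional-boundary (quantifier-free (componentᶠ j)) a
    (λ {y} {y′} h h′ → same (sound y h) (sound y′ h′))
    (lookup b j)
    (⇒T (quantifier-free-reflects (componentᶠ j) (lookup b j ∷ a))
        (from (component-⊨ j (lookup b j) a) (b , φab , refl)))
    where
    sound : ∀ y → T (eval (quantifier-free (componentᶠ j)) (y ∷ a)) →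
            ∃ λ b → (a ++ b ⊨ φ) × y ≡ lookup b j
    sound y h = to (component-⊨ j y a) (T⇒ (quantifier-free-reflects (componentᶠ j) (y ∷ a)) h)
    same : ∀ {y y′} → ∃ (λ b → (a ++ b ⊨ φ) × y ≡ lookup b j) →
           ∃ (λ b → (a ++ b ⊨ φ) × y′ ≡ lookup b j) → y ≡ y′
    same (_ , h , eq) (_ , h′ , eq′) =
      trans eq (trans (cong (λ b → lookup b j) (unique a h h′)) (sym eq′))

-- Cutting overlapping candidate sets into disjoint pieces

choices : ∀ {a} {A : Set a} → (Fin q → List A) → List (Vec A q)
choices {zero}  L = [] ∷ []
choices {suc q} L = cartesianProductWith _∷_ (L zero) (choices (L ∘ suc))

choices⁺ : ∀ {a b r} {A : Set a} {B : Set b} {_∼_ : B → A → Set r} (b : Vec B q) {L : Fin q → List A} →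
           (∀ j → Any (lookup b j ∼_) (L j)) → Any (Pointwise _∼_ b) (choices L)
choices⁺ []      h = here []
choices⁺ (y ∷ b) h = Any.cartesianProductWith⁺ _∷_ _∷_ (h zero) (choices⁺ b (h ∘ suc))

Disjoint : Formula m → Formula m → Set
Disjoint φ ψ = ∀ a → a ⊨ φ → ¬ (a ⊨ ψ)

module _ {x} {X : Set x} (F : X → Formula m) where

  -- Several candidates may agree at a point, so their sets overlap; each point is left to the first
  -- set containing it. The label x travels with its formula, as it determines the affine map on the
  -- piece.
  carve : List X → List (X × Formula m)
  carve []       = []
  carve (x ∷ xs) = (x , F x) ∷ List.map (Product.map₂ (_∧ᶠ ¬ᶠ F x)) (carve xs)

  carve-refines : ∀ xs → All (λ (x , φ) → ∀ a → a ⊨ φ → a ⊨ F x) (carve xs)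
  carve-refines []       = []
  carve-refines (x ∷ xs) = (λ _ h → h) ∷ All.map⁺ (All.map (λ f a (h , _) → f a h) (carve-refines xs))

  carve-disjoint : ∀ xs → AllPairs (λ (_ , φ) (_ , ψ) → Disjoint φ ψ) (carve xs)
  carve-disjoint []       = []
  carve-disjoint (x ∷ xs) =
    All.map⁺ (All.tabulate (λ _ a h (_ , ¬h) → ¬h h)) ∷
    AllPairs.map⁺ (AllPairs.map (λ d a (h , _) (h′ , _) → d a h h′) (carve-disjoint xs))

  carve-covers : ∀ xs a → Any (λ x → a ⊨ F x) xs → Any (λ (_ , φ) → a ⊨ φ) (carve xs)
  carve-covers (x ∷ xs) a (here h) = here h
  -- Either the head takes a, or a satisfies the added conjunct ¬ F x and stays in the piece found
  -- in the tail.
  carve-covers (x ∷ xs) a (there p) with a ⊨? F x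
  ... | yes h = here h
  ... | no ¬h = there (Any.map⁺ (Any.map (λ h → h , ¬h) (carve-covers xs a p)))

-- `AllPairs` relates earlier entries to later ones; symmetry supplies the other order.
AllPairs-lookup : ∀ {a r} {A : Set a} {_∼_ : A → A → Set r} → (∀ {x y} → x ∼ y → y ∼ x) →
  ∀ {xs} → AllPairs _∼_ xs → ∀ {i j} → i ≢ j → List.lookup xs i ∼ List.lookup xs j
AllPairs-lookup s (x∼ ∷ p) {zero}  {zero}  i≢j = contradiction refl i≢j
AllPairs-lookup s {_ ∷ xs} (x∼ ∷ p) {zero}  {suc j} i≢j = All.lookup x∼ (List.∈-lookup j)
AllPairs-lookup s {_ ∷ xs} (x∼ ∷ p) {suc i} {zero}  i≢j = s (All.lookup x∼ (List.∈-lookup i))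
AllPairs-lookup s (x∼ ∷ p) {suc i} {suc j} i≢j = AllPairs-lookup s p (i≢j ∘ cong suc)

-- Affine maps with rational coefficients

ι : ℤ → ℚ
ι z = z / 1

-- Comparison after `toℚᵘ` keeps the reduction to lowest terms out of sight.
fromℚᵘ-homo-+ : ∀ p r → ℚ.fromℚᵘ (p ℚᵘ.+ r) ≡ ℚ.fromℚᵘ p ℚ.+ ℚ.fromℚᵘ r
fromℚᵘ-homo-+ p r = ℚ.toℚᵘ-injective (begin
  ℚ.toℚᵘ (ℚ.fromℚᵘ (p ℚᵘ.+ r))                       ≈⟨ ℚ.toℚᵘ-fromℚᵘ (p ℚᵘ.+ r) ⟩
  p ℚᵘ.+ r                                           ≈⟨ ℚᵘ.+-cong (ℚ.toℚᵘ-fromℚᵘ p) (ℚ.toℚᵘ-fromℚᵘ r) ⟨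
  ℚ.toℚᵘ (ℚ.fromℚᵘ p) ℚᵘ.+ ℚ.toℚᵘ (ℚ.fromℚᵘ r)       ≈⟨ ℚ.toℚᵘ-homo-+ (ℚ.fromℚᵘ p) (ℚ.fromℚᵘ r) ⟨
  ℚ.toℚᵘ (ℚ.fromℚᵘ p ℚ.+ ℚ.fromℚᵘ r)                 ∎)
  where open ℚᵘ.≃-Reasoning

fromℚᵘ-homo-* : ∀ p r → ℚ.fromℚᵘ (p ℚᵘ.* r) ≡ ℚ.fromℚᵘ p ℚ.* ℚ.fromℚᵘ r
fromℚᵘ-homo-* p r = ℚ.toℚᵘ-injective (begin
  ℚ.toℚᵘ (ℚ.fromℚᵘ (p ℚᵘ.* r))                       ≈⟨ ℚ.toℚᵘ-fromℚᵘ (p ℚᵘ.* r) ⟩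
  p ℚᵘ.* r                                           ≈⟨ ℚᵘ.*-cong (ℚ.toℚᵘ-fromℚᵘ p) (ℚ.toℚᵘ-fromℚᵘ r) ⟨
  ℚ.toℚᵘ (ℚ.fromℚᵘ p) ℚᵘ.* ℚ.toℚᵘ (ℚ.fromℚᵘ r)       ≈⟨ ℚ.toℚᵘ-homo-* (ℚ.fromℚᵘ p) (ℚ.fromℚᵘ r) ⟨
  ℚ.toℚᵘ (ℚ.fromℚᵘ p ℚ.* ℚ.fromℚᵘ r)                 ∎)
  where open ℚᵘ.≃-Reasoning

ι-+ : ∀ a b → ι (a + b) ≡ ι a ℚ.+ ι b
ι-+ a b = trans
  (ℚ.fromℚᵘ-cong {mkℚᵘ (a + b) 0} {mkℚᵘ a 0 ℚᵘ.+ mkℚᵘ b 0} (*≡* (lemma a b)))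
  (fromℚᵘ-homo-+ (mkℚᵘ a 0) (mkℚᵘ b 0))
  where
  lemma : ∀ a b → (a + b) * 1ℤ ≡ (a * 1ℤ + b * 1ℤ) * 1ℤ
  lemma = solve-∀

ι-* : ∀ a b → ι (a * b) ≡ ι a ℚ.* ι b
ι-* a b = fromℚᵘ-homo-* (mkℚᵘ a 0) (mkℚᵘ b 0)

ι-injective : ∀ {a b} → ι a ≡ ι b → a ≡ b
ι-injective {a} {b} eq with ℚ./-injective-≃ (mkℚᵘ a 0) (mkℚᵘ b 0) eq
... | *≡* a*1≡b*1 = trans (sym (ℤ.*-identityʳ a)) (trans a*1≡b*1 (ℤ.*-identityʳ b))

/-cancel : ∀ d k → ι +[1+ d ] ℚ.* (k / suc d) ≡ ι k
/-cancel d k = trans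
  (sym (fromℚᵘ-homo-* (mkℚᵘ +[1+ d ] 0) (mkℚᵘ k d)))
  (ℚ.fromℚᵘ-cong {mkℚᵘ +[1+ d ] 0 ℚᵘ.* mkℚᵘ k d} {mkℚᵘ k 0}
    -- The denominator 1 * suc d of the product computes to `suc (d ℕ.+ 0)`, not to `suc d`.
    (*≡* (trans (lemma +[1+ d ] k) (cong (λ e → k * + suc e) (sym (ℕ.+-identityʳ d))))))
  where
  lemma : ∀ e k → e * k * 1ℤ ≡ k * e
  lemma = solve-∀

ι-cancel : ∀ d {p r} → ι +[1+ d ] ℚ.* p ≡ ι +[1+ d ] ℚ.* r → p ≡ r
ι-cancel d {p} {r} eq = trans (sym (inverse p)) (trans (cong (1ℤ / suc d ℚ.*_) eq) (inverse r))
  where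
  inverse : ∀ p → 1ℤ / suc d ℚ.* (ι +[1+ d ] ℚ.* p) ≡ p
  inverse p = trans (sym (ℚ.*-assoc (1ℤ / suc d) (ι +[1+ d ]) p))
    (trans (cong (ℚ._* p) (trans (ℚ.*-comm (1ℤ / suc d) (ι +[1+ d ])) (/-cancel d 1ℤ))) (ℚ.*-identityˡ p))

evalℚ : Vec ℚ n → ℚ → Vec ℤ n → ℚ
evalℚ []      v []      = v
evalℚ (p ∷ r) v (y ∷ a) = p ℚ.* ι y ℚ.+ evalℚ r v a

infix 4 _Represents_,_
-- The bridge between two encodings of a rational affine function: an integral form over one
-- denominator, as elimination produces, and rational coefficients, as in `Linear`.
-- `quotient-represents` leads from the first to the second, `clear-represents` back.
_Represents_,_ : Quotient n → Vec ℚ n → ℚ → Set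
(d , u) Represents r , v = ∀ a → ι (⟦ u ⟧ᵃ a) ≡ ι +[1+ d ] ℚ.* evalℚ r v a

represents-≐ : ∀ {σ : Quotient n} r v → σ Represents r , v → ∀ {y a} → (y ≐ σ at a) ⇔ (ι y ≡ evalℚ r v a)
represents-≐ {σ = d , u} r v rep {y} {a} = mk⇔
  (λ eq → ι-cancel d (trans (sym (ι-* +[1+ d ] y)) (trans (cong ι eq) (rep a))))
  (λ eq → ι-injective (trans (ι-* +[1+ d ] y) (trans (cong (ι +[1+ d ] ℚ.*_) eq) (sym (rep a)))))

coefficients : ℕ → Affine n → Vec ℚ n
coefficients {zero}  d _       = []
coefficients {suc n} d (c ∷ u) = c / suc d ∷ coefficients d u

offset : ℕ → Affine n → ℚ
offset {zero}  d (k ∷ _) = k / suc d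
offset {suc n} d (c ∷ u) = offset d u

quotient-represents : ∀ d (u : Affine n) → (d , u) Represents coefficients d u , offset d u
quotient-represents d (k ∷ []) [] = sym (/-cancel d k)
quotient-represents d (c ∷ u) (y ∷ a) = begin
  ι (c * y + ⟦ u ⟧ᵃ a)                                 ≡⟨ ι-+ (c * y) (⟦ u ⟧ᵃ a) ⟩
  ι (c * y) ℚ.+ ι (⟦ u ⟧ᵃ a)                           ≡⟨ cong₂ ℚ._+_ (ι-* c y) (quotient-represents d u a) ⟩
  ι c ℚ.* ι y ℚ.+ D ℚ.* R                              ≡⟨ cong (λ z → z ℚ.* ι y ℚ.+ D ℚ.* R) (/-cancel d c) ⟨
  D ℚ.* (c / suc d) ℚ.* ι y ℚ.+ D ℚ.* R
    ≡⟨ solve 4 (λ D p y R → D :* p :* y :+ D :* R := D :* (p :* y :+ R)) refl D (c / suc d) (ι y) R ⟩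
  D ℚ.* (c / suc d ℚ.* ι y ℚ.+ R)                      ∎
  where
  open ≡-Reasoning
  open +-*-Solver
  D = ι +[1+ d ]
  R = evalℚ (coefficients d u) (offset d u) a

numerator-cancel : ∀ p → ι +[1+ ℚ.denominator-1 p ] ℚ.* p ≡ ι (ℚ.↥ p)
numerator-cancel p = trans (cong (ι +[1+ ℚ.denominator-1 p ] ℚ.*_) (sym (ℚ.↥p/↧p≡p p)))
                           (/-cancel (ℚ.denominator-1 p) (ℚ.↥ p))

-- The common denominator is the product of all denominators: d + e (1 + d) is (1 + e) (1 + d) - 1.
clear : Vec ℚ n → ℚ → Quotient n
clear []      v = ℚ.denominator-1 v , ℚ.↥ v ∷ []
clear (p ∷ r) v = let e = ℚ.denominator-1 p ; (d , u) = clear r v in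
  d ℕ.+ e ℕ.* suc d , +[1+ d ] * ℚ.↥ p ∷ +[1+ e ] ⊛ u

clear-represents : ∀ (r : Vec ℚ n) v → clear r v Represents r , v
clear-represents []      v [] = sym (numerator-cancel v)
clear-represents (p ∷ r) v (y ∷ a) = begin
  ι (+[1+ d ] * N * y + ⟦ +[1+ e ] ⊛ u ⟧ᵃ a)     ≡⟨ ι-+ (+[1+ d ] * N * y) (⟦ +[1+ e ] ⊛ u ⟧ᵃ a) ⟩
  ι (+[1+ d ] * N * y) ℚ.+ ι (⟦ +[1+ e ] ⊛ u ⟧ᵃ a)
    ≡⟨ cong₂ ℚ._+_ (trans (ι-* (+[1+ d ] * N) y) (cong (ℚ._* ι y) (ι-* +[1+ d ] N)))
                   (trans (cong ι (⊛-homo +[1+ e ] u a)) (ι-* +[1+ e ] (⟦ u ⟧ᵃ a))) ⟩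
  D ℚ.* ι N ℚ.* ι y ℚ.+ E ℚ.* ι (⟦ u ⟧ᵃ a)
    ≡⟨ cong₂ (λ s t → D ℚ.* s ℚ.* ι y ℚ.+ E ℚ.* t) (numerator-cancel p) (sym (clear-represents r v a)) ⟨
  D ℚ.* (E ℚ.* p) ℚ.* ι y ℚ.+ E ℚ.* (D ℚ.* R)
    ≡⟨ solve 5 (λ D E p y R → D :* (E :* p) :* y :+ E :* (D :* R) := E :* D :* (p :* y :+ R)) refl D E p (ι y) R ⟩
  E ℚ.* D ℚ.* (p ℚ.* ι y ℚ.+ R)                  ≡⟨ cong (ℚ._* (p ℚ.* ι y ℚ.+ R)) (ι-* +[1+ e ] +[1+ d ]) ⟨
  ι (+[1+ e ] * +[1+ d ]) ℚ.* (p ℚ.* ι y ℚ.+ R)  ∎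
  where
  open ≡-Reasoning
  open +-*-Solver
  d = proj₁ (clear r v)
  u = proj₂ (clear r v)
  e = ℚ.denominator-1 p
  N = ℚ.↥ p
  D = ι +[1+ d ]
  E = ι +[1+ e ]
  R = evalℚ r v a

-- Affine maps on real vectors that are integer points

≗⇒≈ : ∀ {x y : ℝ} → (∀ i → seq x i ≡ seq y i) → x ≈ y
≗⇒≈ {x} {y} eq ε ε>0 = 0 , λ {i} _ →
  subst (λ s → ℚ.∣ seq x i ℚ.- s ∣ ℚ.< ε) (eq i) (∣p-p∣<ε (seq x i) ε>0)

+ℝ-cong : ∀ {x x′ y y′} → x ≈ x′ → y ≈ y′ → x +ℝ y ≈ x′ +ℝ y′
+ℝ-cong {x} {x′} {y} {y′} x≈ y≈ ε ε>0 with x≈ (ℚ.½ ℚ.* ε) (½ε>0 ε>0) | y≈ (ℚ.½ ℚ.* ε) (½ε>0 ε>0)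
... | N , h | N′ , h′ = N ℕ.⊔ N′ , λ {i} le → half-sum
  (solve 4 (λ a b c d → (a :+ b) :- (c :+ d) := (a :- c) :+ (b :- d)) refl
     (seq x i) (seq y i) (seq x′ i) (seq y′ i))
  (h (ℕ.≤-trans (ℕ.m≤m⊔n N N′) le)) (h′ (ℕ.≤-trans (ℕ.m≤n⊔m N N′) le))
  where open +-*-Solver

·-cong : ∀ c {x y} → x ≈ y → c · x ≈ c · y
·-cong c {x} {y} x≈y ε ε>0 with x≈y (Scale.δ c ε ε>0) (Scale.δ>0 c ε ε>0)
... | N , h = N , λ {i} le → Scale.bound c ε ε>0 (seq x i) (seq y i) (h le)

dot-cong : ∀ (r : Vec ℚ n) {x y} → x ≋ y → dot r x ≈ dot r y
dot-cong []      []           = ≈-refl {fromℚ 0ℚ}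
dot-cong (c ∷ r) {x ∷ xs} {y ∷ ys} (x≈y ∷ xs≋ys) =
  +ℝ-cong {c · x} {c · y} {dot r xs} {dot r ys} (·-cong c {x} {y} x≈y) (dot-cong r xs≋ys)

-- At an integer point all the Cauchy sequences involved are constant, so the equality holds at
-- every index.
dot-evalℚ : ∀ (r : Vec ℚ n) v a i → seq (dot r (Vec.map fromℤ a)) i ℚ.+ v ≡ evalℚ r v a
dot-evalℚ []      v []      i = ℚ.+-identityˡ v
dot-evalℚ (c ∷ r) v (y ∷ a) i = trans (ℚ.+-assoc (c ℚ.* ι y) _ v) (cong (c ℚ.* ι y ℚ.+_) (dot-evalℚ r v a i))

affine-≈ : ∀ (r : Vec ℚ n) v {a x} → Vec.map fromℤ a ≋ x → fromℚ (evalℚ r v a) ≈ dot r x +ℝ fromℚ v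
affine-≈ r v {a} {x} a≋x = ≈-trans
  {fromℚ (evalℚ r v a)} {dot r (Vec.map fromℤ a) +ℝ fromℚ v} {dot r x +ℝ fromℚ v}
  (≗⇒≈ {fromℚ (evalℚ r v a)} {dot r (Vec.map fromℤ a) +ℝ fromℚ v} (λ i → sym (dot-evalℚ r v a i)))
  (+ℝ-cong {dot r (Vec.map fromℤ a)} {dot r x} {fromℚ v} {fromℚ v} (dot-cong r a≋x) (≈-refl {fromℚ v}))

fromℚ-injective : ∀ {p r} → fromℚ p ≈ fromℚ r → p ≡ r
fromℚ-injective {p} {r} p≈r with p ℚ.≟ r
... | yes p≡r = p≡r
-- With ε the distance of p and r, convergence would make this distance less than itself.
... | no  p≢r = contradiction (proj₂ (p≈r ℚ.∣ p ℚ.- r ∣ distance>0) ℕ.≤-refl) (ℚ.<-irrefl refl)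
  where
  distance≢0 : ℚ.∣ p ℚ.- r ∣ ≢ 0ℚ
  distance≢0 eq = p≢r (x∙y⁻¹≈ε⇒x≈y p r (ℚ.∣p∣≡0⇒p≡0 (p ℚ.- r) eq))
  distance>0 : 0ℚ ℚ.< ℚ.∣ p ℚ.- r ∣
  distance>0 = ℚ.≰⇒> (λ le → distance≢0 (ℚ.≤-antisym le (ℚ.0≤∣p∣ (p ℚ.- r))))

fromℤ-injective : ∀ {a b : Vec ℤ n} → Vec.map fromℤ a ≋ Vec.map fromℤ b → a ≡ b
fromℤ-injective {a = []}    {[]}    []       = refl
fromℤ-injective {a = y ∷ a} {z ∷ b} (eq ∷ h) = cong₂ _∷_ (ι-injective (fromℚ-injective eq)) (fromℤ-injective h)

module _ {a : Vec ℤ n} {x : Vec ℝ n} (a≋x : Vec.map fromℤ a ≋ x) where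

  quotient-linear : ∀ {b : Vec ℤ q} {σs} → b ≐* σs at a →
    Vec.map fromℤ b ≋ Vec.map (λ (d , u) → coefficients d u) σs *ᵥ x
                    +ᵥ Vec.map fromℚ (Vec.map (λ (d , u) → offset d u) σs)
  quotient-linear [] = []
  quotient-linear {b = y ∷ b} {(d , u) ∷ σs} (eq ∷ h) =
    subst (λ p → fromℚ p ≈ dot r x +ℝ fromℚ v)
      (sym (to (represents-≐ {σ = d , u} r v (quotient-represents d u)) eq)) (affine-≈ r v a≋x)
    ∷ quotient-linear h
    where
    r = coefficients d u
    v = offset d u

  -- At the integer point x the real affine map takes rational values, so by `fromℚ-injective` the
  -- real equation is one between rationals, which `clear` turns into one between integers.
  clear-linear : ∀ (M : Matrix q n) v b →
    (b ≐* zipWith clear M v at a) ⇔ (Vec.map fromℤ b ≋ M *ᵥ x +ᵥ Vec.map fromℚ v)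
  clear-linear []      []      []      = mk⇔ (λ _ → []) (λ _ → [])
  clear-linear (r ∷ M) (v ∷ w) (y ∷ b) = mk⇔
    (λ { (eq ∷ h) → subst (λ p → fromℚ p ≈ dot r x +ℝ fromℚ v) (sym (to equation eq)) (affine-≈ r v a≋x)
                    ∷ to (clear-linear M w b) h })
    (λ { (eq ∷ h) → from equation (fromℚ-injective (≈-trans
                      {fromℤ y} {dot r x +ℝ fromℚ v} {fromℚ (evalℚ r v a)} eq
                      (≈-sym {fromℚ (evalℚ r v a)} {dot r x +ℝ fromℚ v} (affine-≈ r v a≋x))))
                    ∷ from (clear-linear M w b) h })
    where
    equation : (y ≐ clear r v at a) ⇔ (ι y ≡ evalℚ r v a)
    equation = represents-≐ {σ = clear r v} r v (clear-represents r v)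

-- Integer points and partial functions

split-++ : ∀ {x : Vec ℝ n} {y : Vec ℝ q} (a : Vec ℤ n) {b : Vec ℤ q} →
           x ++ y ≋ Vec.map fromℤ (a ++ b) → x ≋ Vec.map fromℤ a × y ≋ Vec.map fromℤ b
split-++ {x = x} a {b} h = ++⁻ x (Vec.map fromℤ a) (≋-trans h (map-++ fromℤ a))

join-++ : ∀ {x : Vec ℝ n} {y : Vec ℝ q} (a : Vec ℤ n) {b : Vec ℤ q} →
          Vec.map fromℤ a ≋ x → Vec.map fromℤ b ≋ y → Vec.map fromℤ (a ++ b) ≋ x ++ y
join-++ a h h′ = ≋-trans (map-++ fromℤ a) (++⁺ h h′)

split-Solutions : ∀ (φ : Formula (n ℕ.+ q)) {x : Vec ℝ n} {y : Vec ℝ q} → x ++ y ∈ Solutions φ →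
  ∃ λ a → ∃ λ b → Vec.map fromℤ a ≋ x × Vec.map fromℤ b ≋ y × (a ++ b ⊨ φ)
split-Solutions {n} φ (c , c≋ , h) with Vec.splitAt n c
... | a , b , refl = let x≋a , y≋b = split-++ a (≋-sym c≋) in a , b , ≋-sym x≋a , ≋-sym y≋b , h

-- The blocks of a partition live at the level of the domain, whereas `Solutions` lives at level 0.
raise : Subset n 0ℓ → Subset n ℓ
raise {ℓ = ℓ} S = record
  { member   = λ x → Lift ℓ (member S x)
  ; respects = λ x≋y (lift h) → lift (respects S x≋y h)
  }

-- From definable to piecewise linear functions

module _ (f : PartialFunction n q ℓ) (φ : Formula (n ℕ.+ q))
         (graph⊆ : Graph f ⊆ Solutions φ) (⊆graph : Solutions φ ⊆ Graph f) where

  -- Membership in the graph is up to `_≋_`, so what it provides is a point of the domain equal to a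
  -- as a real vector.
  integer-point : ∀ (a : Vec ℤ n) (b : Vec ℤ q) → a ++ b ⊨ φ →
    ∃ λ x → ∃ λ (x∈ : x ∈ dom f) → x ≋ Vec.map fromℤ a × apply f x x∈ ≋ Vec.map fromℤ b
  integer-point a b φab =
    let x , x∈ , eq = ⊆graph {Vec.map fromℤ (a ++ b)} (a ++ b , ≋-refl {x = Vec.map fromℤ (a ++ b)} , φab)
    in x , x∈ , split-++ a eq

  dom-integer : ∀ (a : Vec ℤ n) (b : Vec ℤ q) → a ++ b ⊨ φ → ∀ {x} → Vec.map fromℤ a ≋ x → x ∈ dom f
  dom-integer a b φab a≋x =
    let x′ , x′∈ , x′≋a , _ = integer-point a b φab
    in respects (dom f) {x′} (≋-trans x′≋a a≋x) x′∈

  apply-integer : ∀ (a : Vec ℤ n) (b : Vec ℤ q) → a ++ b ⊨ φ → ∀ {x} → Vec.map fromℤ a ≋ x →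
                  (x∈ : x ∈ dom f) → apply f x x∈ ≋ Vec.map fromℤ b
  apply-integer a b φab {x} a≋x x∈ =
    let x′ , x′∈ , x′≋a , fx′≋b = integer-point a b φab
    in ≋-trans (apply-cong f x∈ x′∈ (≋-sym (≋-trans x′≋a a≋x))) fx′≋b

  -- Both outputs are the value of f at a, and integer tuples with equal real images coincide.
  functional : Functional n q φ
  functional a {b} {b′} h h′ = fromℤ-injective
    (≋-trans (≋-sym (apply-integer a b h a≋a x∈)) (apply-integer a b′ h′ a≋a x∈))
    where
    a≋a : Vec.map fromℤ a ≋ Vec.map fromℤ a
    a≋a = ≋-refl
    x∈ : Vec.map fromℤ a ∈ dom f
    x∈ = dom-integer a b h a≋a

  pieceᶠ : Vec (Quotient n) q → Formula n
  pieceᶠ σs = ∃ʳ q (φ ∧ᶠ graphᶠ σs)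

  piece-⊨ : ∀ σs a → (a ⊨ pieceᶠ σs) ⇔ ∃ λ b → (a ++ b ⊨ φ) × (b ≐* σs at a)
  piece-⊨ σs a = mk⇔
    (λ h → case to (∃ʳ-⊨ q (φ ∧ᶠ graphᶠ σs) a) h of λ (b , φab , g) → b , φab , to (graph-⊨ σs a b) g)
    (λ (b , φab , eq) → from (∃ʳ-⊨ q (φ ∧ᶠ graphᶠ σs) a) (b , φab , from (graph-⊨ σs a b) eq))

  satisfiable-piece? = λ ((_ , ψ) : Vec (Quotient n) q × Formula n) → satisfiable? ψ

  candidate-pieces pieces : List (Vec (Quotient n) q × Formula n)
  candidate-pieces = carve pieceᶠ (choices (values n q φ))
  pieces = List.filter satisfiable-piece? candidate-pieces

  piece-covers : ∀ a b → a ++ b ⊨ φ → Any (λ (_ , ψ) → a ⊨ ψ) pieces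
  piece-covers a b φab = case Any.filter⁺ satisfiable-piece? covered of λ
    { (inj₁ p)    → p
    -- A piece that contains a is satisfiable, so the filter has kept it.
    ; (inj₂ ¬sat) → contradiction (a , Any.lookup-result covered) ¬sat
    }
    where
    covered : Any (λ (_ , ψ) → a ⊨ ψ) candidate-pieces
    covered = carve-covers pieceᶠ (choices (values n q φ)) a
      (Any.map (λ {σs} eq → from (piece-⊨ σs a) (b , φab , eq))
        (choices⁺ b (value-listed n q φ functional a b φab)))

  definable⇒piecewise-linear : PiecewiseLinear f
  definable⇒piecewise-linear = partition , definable , linear
    where
    piece : Fin (List.length pieces) → Formula n
    piece i = proj₂ (List.lookup pieces i)

    meaning : ∀ i a → a ⊨ piece i → ∃ λ b → (a ++ b ⊨ φ) × (b ≐* proj₁ (List.lookup pieces i) at a)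
    meaning i a h = to (piece-⊨ (proj₁ (List.lookup pieces i)) a)
      (All.lookup (All.filter⁺ satisfiable-piece? (carve-refines pieceᶠ (choices (values n q φ))))
                  (List.∈-lookup i) a h)

    partition : FinitePartition (dom f)
    partition = record
      { size     = List.length pieces
      ; block    = λ i → raise (Solutions (piece i))
      ; nonempty = λ i → case All.lookup (All.all-filter satisfiable-piece? candidate-pieces)
                                   (List.∈-lookup i) of
          λ (a , h) → Vec.map fromℤ a , lift (a , ≋-refl , h)
      -- The two memberships come with integer tuples a and a′; both map to x, hence they are equal
      -- and disjointness of the formulas applies.
      ; disjoint = λ { {i} {j} i≢j x (lift (a , a≋x , h)) (lift (a′ , a′≋x , h′)) →
          AllPairs-lookup (λ d a h h′ → d a h′ h)
            (AllPairs.filter⁺ satisfiable-piece? (carve-disjoint pieceᶠ (choices (values n q φ))))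
            i≢j a h (subst (_⊨ piece j) (fromℤ-injective (≋-trans a′≋x (≋-sym a≋x))) h′) }
      ; included = λ { i (lift (a , a≋x , h)) →
          case meaning i a h of λ (b , φab , _) → dom-integer a b φab a≋x }
      ; covers   = covers-dom
      }
      where
      covers-dom : ∀ x → x ∈ dom f → ∃ λ i → Lift ℓ (x ∈ Solutions (piece i))
      covers-dom x x∈ =
        let a , b , a≋x , _ , φab = split-Solutions φ {x} {apply f x x∈}
              (graph⊆ {x ++ apply f x x∈} (x , x∈ , ≋-refl))
            p = piece-covers a b φab
        in Any.index p , lift (a , a≋x , Any.lookup-index p)

    definable : ∀ i → DefinableSet (block partition i)
    definable i = piece i , lower , lift

    linear : ∀ i → Linear (restrict f (block partition i) (included partition i))
    -- The matrix and the vector are those of `quotient-linear` for the quotients that label the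
    -- piece.
    linear i = _ , _ , λ { x x∈@(lift (a , a≋x , h)) → case meaning i a h of λ (b , φab , eq) →
      ≋-trans (apply-integer a b φab a≋x (included partition i x∈)) (quotient-linear a≋x eq) }

-- From piecewise linear to definable functions

module _ (f : PartialFunction n q ℓ) (integral : IntegerValued f) (Π : FinitePartition (dom f))
         (definable : ∀ i → DefinableSet (block Π i))
         (linear : ∀ i → Linear (restrict f (block Π i) (included Π i))) where

  blockᶠ : Fin (size Π) → Formula n
  blockᶠ i = proj₁ (definable i)

  quotients : Fin (size Π) → Vec (Quotient n) q
  quotients i = zipWith clear (proj₁ (linear i)) (proj₁ (proj₂ (linear i)))

  branchᶠ : Fin (size Π) → Formula (n ℕ.+ q)
  branchᶠ i = rename (_↑ˡ q) (blockᶠ i) ∧ᶠ graphᶠ (quotients i)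

  branch-⊨ : ∀ i a b → (a ++ b ⊨ branchᶠ i) ⇔ ((a ⊨ blockᶠ i) × (b ≐* quotients i at a))
  branch-⊨ i a b =
    ⇔-sym (rename-⊨ (λ j → sym (Vec.lookup-++ˡ a b j)) (blockᶠ i)) ×-⇔ graph-⊨ (quotients i) a b

  block-linear : ∀ i {a b x} → Vec.map fromℤ a ≋ x → (x∈ : x ∈ block Π i) →
    (b ≐* quotients i at a) ⇔ (Vec.map fromℤ b ≋ apply f x (included Π i x∈))
  block-linear i {a} {b} {x} a≋x x∈ =
    let M , v , affine = linear i
        equation = clear-linear a≋x M v b
    in mk⇔ (λ h → ≋-trans (to equation h) (≋-sym (affine x x∈)))
           (λ h → from equation (≋-trans h (affine x x∈)))

  piecewise-linear⇒definable : Definable f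
  piecewise-linear⇒definable = ⋁ branchᶠ , (λ {z} → graph⊆ z) , (λ {z} → ⊆graph z)
    where
    graph⊆ : ∀ z → z ∈ Graph f → z ∈ Solutions (⋁ branchᶠ)
    graph⊆ z (x , x∈ , eq) =
      let i , x∈i = covers Π x x∈
          -- Integrality enters here: only an integer tuple can satisfy the formula.
          b , fx≋b = integral x x∈
          a , a≋x , a⊨ = proj₁ (proj₂ (definable i)) {x} x∈i
          -- The block gives its own proof that x lies in the domain; by `apply-cong` the value is
          -- the same for both proofs.
          fx≋b′ = ≋-trans (apply-cong f (included Π i x∈i) x∈ ≋-refl) fx≋b
      in a ++ b , ≋-trans (join-++ a a≋x (≋-sym fx≋b)) eq ,
         from (⋁-⊨ branchᶠ (a ++ b))
           (i , from (branch-⊨ i a b) (a⊨ , from (block-linear i a≋x x∈i) (≋-sym fx≋b′)))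

    ⊆graph : ∀ z → z ∈ Solutions (⋁ branchᶠ) → z ∈ Graph f
    ⊆graph z (c , c≋z , h) with Vec.splitAt n c
    ... | a , b , refl =
      let i , hᵢ = to (⋁-⊨ branchᶠ (a ++ b)) h
          a⊨ , b≐ = to (branch-⊨ i a b) hᵢ
          x = Vec.map fromℤ a
          a≋a = ≋-refl {x = x}
          x∈i = proj₂ (proj₂ (definable i)) {x} (a , a≋a , a⊨)
      in x , included Π i x∈i , ≋-trans (≋-sym (join-++ a a≋a (to (block-linear i a≋a x∈i) b≐))) c≋z

theorem4p2 : ∀ {ℓ} {n q} (f : PartialFunction n q ℓ) →
    (Definable f → PiecewiseLinear f) ×
    (IntegerValued f → PiecewiseLinear f → Definable f)
theorem4p2 f =
  (λ (φ , graph⊆ , ⊆graph) → definable⇒piecewise-linear f φ graph⊆ ⊆graph) ,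
  (λ integral (Π , definable , linear) → piecewise-linear⇒definable f integral Π definable linear)
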